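{- Let $G$ be a bipartite connected graph with $n \geq 4$ vertices and $m \geq n$ edges. Then $$Sz(G)-W(G) \geq 4n-8.$$ Moreover, the bound is best possible: equality is attained by the graph composed of a cycle $C_4$ on $4$ vertices and a tree $T$ on $n-3$ vertices sharing a single vertex.
   Context: All graphs are finite, undirected and simple. For vertices $u,v$ of $G=(V,E)$, $d(u,v)$ is the distance between them. The Wiener index is $W(G)=\sum_{\{u,v\}\subseteq V} d(u,v)$. For an edge $e=uv$, let $N_u(e)=\{w\in V: d(u,w)<d(v,w)\}$, $N_v(e)=\{w\in V: d(v,w)<d(u,w)\}$, and $n_u(e)=|N_u(e)|$, $n_v(e)=|N_v(e)|$. The Szeged index is $Sz(G)=\sum_{e=uv\in E} n_u(e)n_v(e)$. -}

module Defs where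

open import Data.Nat using (ℕ; zero; suc; _+_; _*_; _∸_; _<ᵇ_)
open import Data.Bool using (Bool; true; false; if_then_else_; _∧_; _∨_; not)
open import Data.Fin using (Fin; toℕ; splitAt)
open import Data.Fin.Properties using (_≟_)
open import Data.List using (List; map; allFin)
open import Data.Nat.ListAction using (sum)
open import Data.Bool.ListAction using (any)
open import Data.Product using (Σ; ∃; ∃-syntax; _×_)
open import Data.Sum using (inj₁; inj₂)
open import Relation.Nullary.Decidable using (⌊_⌋)
open import Relation.Binary.PropositionalEquality using (_≡_; _≢_; refl)
import Data.Fin as Fin

record Graph (n : ℕ) : Set where
  field
    adj    : Fin n → Fin n → Bool
    sym    : ∀ u v → adj u v ≡ adj v u
    irrefl : ∀ u → adj u u ≡ false
open Graph public

Σv : ∀ {n} → (Fin n → ℕ) → ℕ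
Σv {n} f = sum (map f (allFin n))

Σpairs : ∀ {n} → (Fin n → Fin n → ℕ) → ℕ
Σpairs f = Σv (λ u → Σv (λ v → if toℕ u <ᵇ toℕ v then f u v else 0))

reach : ∀ {n} → Graph n → ℕ → Fin n → Fin n → Bool
reach G zero    u v = ⌊ u ≟ v ⌋
reach {n} G (suc k) u v =
  reach G k u v ∨ any (λ w → reach G k u w ∧ adj G w v) (allFin n)

Connected : ∀ {n} → Graph n → Set
Connected G = ∀ u v → ∃[ k ] (reach G k u v ≡ true)

Bipartite : ∀ {n} → Graph n → Set
Bipartite {n} G = Σ (Fin n → Bool) (λ c → ∀ (u v : Fin n) → adj G u v ≡ true → c u ≢ c v)

-- distance: least k with a walk of length ≤ k (search over k < n suffices in a
-- connected graph on n vertices; the fallback value n is never used there)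
dist : ∀ {n} → Graph n → Fin n → Fin n → ℕ
dist {n} G u v = search 0 n
  where
  search : ℕ → ℕ → ℕ
  search k zero    = k
  search k (suc f) = if reach G k u v then k else search (suc k) f

edgeCount : ∀ {n} → Graph n → ℕ
edgeCount G = Σpairs (λ u v → if adj G u v then 1 else 0)

W : ∀ {n} → Graph n → ℕ
W G = Σpairs (dist G)

nClose : ∀ {n} → Graph n → Fin n → Fin n → ℕ
nClose G u v = Σv (λ w → if dist G u w <ᵇ dist G v w then 1 else 0)

Sz : ∀ {n} → Graph n → ℕ
Sz G = Σpairs (λ u v → if adj G u v then nClose G u v * nClose G v u else 0)

Tree : ∀ {k} → Graph k → Set
Tree {k} T = Connected T × edgeCount T ≡ k ∸ 1

-- The graph obtained from a tree T on suc j vertices and a 4-cycle C4 sharing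
-- the single vertex s of T.  Vertices: inj₁ x (tree vertices, via splitAt) and
-- three new cycle vertices inj₂ 0, 1, 2; the cycle is s - 0 - 1 - 2 - s.
private
  c3 : Fin 3 → Fin 3 → Bool
  c3 Fin.zero (Fin.suc Fin.zero) = true
  c3 (Fin.suc Fin.zero) Fin.zero = true
  c3 (Fin.suc Fin.zero) (Fin.suc (Fin.suc Fin.zero)) = true
  c3 (Fin.suc (Fin.suc Fin.zero)) (Fin.suc Fin.zero) = true
  c3 _ _ = false

  c3-sym : ∀ a b → c3 a b ≡ c3 b a
  c3-sym Fin.zero Fin.zero = refl
  c3-sym Fin.zero (Fin.suc Fin.zero) = refl
  c3-sym Fin.zero (Fin.suc (Fin.suc Fin.zero)) = refl
  c3-sym (Fin.suc Fin.zero) Fin.zero = refl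
  c3-sym (Fin.suc Fin.zero) (Fin.suc Fin.zero) = refl
  c3-sym (Fin.suc Fin.zero) (Fin.suc (Fin.suc Fin.zero)) = refl
  c3-sym (Fin.suc (Fin.suc Fin.zero)) Fin.zero = refl
  c3-sym (Fin.suc (Fin.suc Fin.zero)) (Fin.suc Fin.zero) = refl
  c3-sym (Fin.suc (Fin.suc Fin.zero)) (Fin.suc (Fin.suc Fin.zero)) = refl

  c3-irr : ∀ a → c3 a a ≡ false
  c3-irr Fin.zero = refl
  c3-irr (Fin.suc Fin.zero) = refl
  c3-irr (Fin.suc (Fin.suc Fin.zero)) = refl

  att : ∀ {j} → Fin (suc j) → Fin (suc j) → Fin 3 → Bool
  att s x Fin.zero = ⌊ x ≟ s ⌋
  att s x (Fin.suc (Fin.suc Fin.zero)) = ⌊ x ≟ s ⌋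
  att s x _ = false

gAdj : ∀ {j} → Graph (suc j) → Fin (suc j) → Fin (suc j + 3) → Fin (suc j + 3) → Bool
gAdj {j} T s a b with splitAt (suc j) a | splitAt (suc j) b
... | inj₁ x | inj₁ y = adj T x y
... | inj₁ x | inj₂ z = att s x z
... | inj₂ z | inj₁ x = att s x z
... | inj₂ z | inj₂ z′ = c3 z z′

private
  gAdj-sym : ∀ {j} (T : Graph (suc j)) s a b → gAdj T s a b ≡ gAdj T s b a
  gAdj-sym {j} T s a b with splitAt (suc j) a | splitAt (suc j) b
  ... | inj₁ x | inj₁ y = sym T x y
  ... | inj₁ x | inj₂ z = refl
  ... | inj₂ z | inj₁ x = refl
  ... | inj₂ z | inj₂ z′ = c3-sym z z′

  gAdj-irr : ∀ {j} (T : Graph (suc j)) s a → gAdj T s a a ≡ false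
  gAdj-irr {j} T s a with splitAt (suc j) a
  ... | inj₁ x = irrefl T x
  ... | inj₂ z = c3-irr z

C4⊙T : ∀ {j} → Graph (suc j) → Fin (suc j) → Graph (suc j + 3)
C4⊙T T s = record { adj = gAdj T s ; sym = gAdj-sym T s ; irrefl = gAdj-irr T s }

{-# OPTIONS --safe #-}

-- For bipartite G, counting the edges uv that separate x from y (x closer to u, y closer to v) gives
-- 2 Sz(G) = Σ μ(x,y) over ordered pairs, and μ ≥ d since every edge of a geodesic separates its ends.
-- If x and r are joined by two internally disjoint geodesics of length p, the 2p edges of this cycle
-- each separate any vertex v from exactly one of x and r, which forces
-- μ(v,x) + μ(v,r) ≥ d(v,x) + d(v,r) + p. As m ≥ n, some vertex has two neighbours closer to a root, and
-- following parents from both yields such a pair. One pair with p ≥ 4, or two disjoint antipodal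
-- pairs of a 4-cycle or hexagon, give a set L of at most four vertices with Σ_{x ∈ L} (μ − d)(v,x) ≥ 4
-- for every v, hence 2 (Sz − W) ≥ 4n + 4(n − 4).
-- In a tree counting edges shows that vertices have unique parents with respect to every root, so
-- μ = d; the Szeged index of C₄ glued to a tree is then computed from its explicit metric.

module Submission where

open import Defs hiding (sym)
open import Data.Nat
open import Data.Nat.Properties
open import Data.Nat.Induction using (<-wellFounded)
open import Data.Nat.ListAction using (sum)
open import Data.Nat.ListAction.Properties using (sum-++; sum-↭)
open import Data.Nat.Tactic.RingSolver using (solve-∀)
open import Data.Bool using (Bool; true; false; if_then_else_; not; T; _∨_; _∧_; _xor_)
open import Data.Bool.ListAction using (any)
open import Data.Bool.Properties using (T-≡; ∨-zeroʳ) renaming (_≟_ to _≟ᵇ_)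
open import Data.Fin using (Fin; toℕ; fromℕ<; join; splitAt; _↑ˡ_; _↑ʳ_)
open import Data.Fin.Patterns using (0F; 1F; 2F)
import Data.Fin as Fin
import Data.Fin.Properties as Fin
open import Data.List using (List; []; _∷_; _++_; map; length; allFin; tabulate; applyUpTo; cartesianProduct)
open import Data.List.Properties using (map-++; map-∘; map-tabulate; length-++; length-applyUpTo; length-tabulate)
open import Data.List.Membership.Propositional using (_∈_; find; lose)
open import Data.List.Membership.Propositional.Properties using (∈-∃++; ∈-++⁻; ∈-allFin; ∈-applyUpTo⁻; ∈-cartesianProduct⁺)
open import Data.List.Relation.Unary.Any using (here; there)
open import Data.List.Relation.Unary.Any.Properties using (any⁺; any⁻)
import Data.List.Relation.Unary.All as All
open import Data.List.Relation.Unary.All using ([]; _∷_)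
open import Data.List.Relation.Unary.AllPairs using ([]; _∷_)
open import Data.List.Relation.Unary.Unique.Propositional using (Unique)
open import Data.List.Relation.Unary.Unique.Propositional.Properties using (++⁺; allFin⁺; applyUpTo⁺₁)
open import Data.List.Relation.Binary.Permutation.Propositional using (_↭_; ↭-refl; ↭-trans; prep)
open import Data.List.Relation.Binary.Permutation.Propositional.Properties using (shift; ∈-resp-↭; ↭-length) renaming (map⁺ to ↭-map⁺)
open import Data.Product using (∃-syntax; _×_; _,_; proj₁; proj₂; uncurry)
open import Data.Sum using (_⊎_; inj₁; inj₂; [_,_]′)
open import Function using (_∘_; id; Equivalence)
open import Induction.WellFounded using (Acc; acc)
open import Relation.Nullary using (yes; no; contradiction)
open import Relation.Nullary.Decidable using (⌊_⌋; from-yes; _→-dec_)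
open import Relation.Binary using (tri<; tri≈; tri>)
open import Relation.Binary.PropositionalEquality

-- A single pair can have `μ v x` equal to `d v x`, so no pair by itself can be shown to gain; only
-- the sum over two antipodes is forced up. One antipodal pair of a short cycle gains just 2 or 3
-- per vertex, while 4 is needed, which is why those lengths call for a second pair; four vertices
-- are the most that the count of pairs can bear. Bipartiteness enters through `Graded`, a property
-- that trees obtain from edge counting instead. As `dist` is a bounded search, distances are
-- characterised by the local conditions of `IsMetric`; a metric guessed for the glued graph then
-- only has to satisfy these. For that graph only the upper bound on Sz is computed, since the lower
-- one is an instance of the general bound.

private variable
  Index Index′ : Set
  n : ℕ

-- Finite sums

∑ : List Index → (Index → ℕ) → ℕ
∑ xs f = sum (map f xs)

∑-cong : ∀ (xs : List Index) {f g : Index → ℕ} → (∀ x → f x ≡ g x) → ∑ xs f ≡ ∑ xs g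
∑-cong []       f≡g = refl
∑-cong (x ∷ xs) f≡g = cong₂ _+_ (f≡g x) (∑-cong xs f≡g)

∑-mono : ∀ (xs : List Index) {f g : Index → ℕ} → (∀ x → f x ≤ g x) → ∑ xs f ≤ ∑ xs g
∑-mono []       f≤g = z≤n
∑-mono (x ∷ xs) f≤g = +-mono-≤ (f≤g x) (∑-mono xs f≤g)

∑-lower : ∀ (xs : List Index) {f : Index → ℕ} c → (∀ {x} → x ∈ xs → c ≤ f x) → length xs * c ≤ ∑ xs f
∑-lower []       c c≤f = z≤n
∑-lower (x ∷ xs) c c≤f = +-mono-≤ (c≤f (here refl)) (∑-lower xs c (c≤f ∘ there))

∑-upper : ∀ (xs : List Index) {f : Index → ℕ} c → (∀ x → f x ≤ c) → ∑ xs f ≤ length xs * c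
∑-upper []       c f≤c = z≤n
∑-upper (x ∷ xs) c f≤c = +-mono-≤ (f≤c x) (∑-upper xs c f≤c)

∑-const : ∀ (xs : List Index) c → ∑ xs (λ _ → c) ≡ length xs * c
∑-const []       c = refl
∑-const (x ∷ xs) c = cong (c +_) (∑-const xs c)

∑-zero : ∀ (xs : List Index) → ∑ xs (λ _ → 0) ≡ 0
∑-zero xs = trans (∑-const xs 0) (*-zeroʳ (length xs))

∑-+ : ∀ (xs : List Index) (f g : Index → ℕ) → ∑ xs (λ x → f x + g x) ≡ ∑ xs f + ∑ xs g
∑-+ []       f g = refl
∑-+ (x ∷ xs) f g = trans (cong (f x + g x +_) (∑-+ xs f g)) (interchange (f x) (g x) (∑ xs f) (∑ xs g))
  where
  interchange : ∀ a b c d → a + b + (c + d) ≡ a + c + (b + d)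
  interchange = solve-∀

∑-*ˡ : ∀ (xs : List Index) c (f : Index → ℕ) → ∑ xs (λ x → c * f x) ≡ c * ∑ xs f
∑-*ˡ []       c f = sym (*-zeroʳ c)
∑-*ˡ (x ∷ xs) c f = trans (cong (c * f x +_) (∑-*ˡ xs c f)) (sym (*-distribˡ-+ c (f x) (∑ xs f)))

∑-*ʳ : ∀ (xs : List Index) c (f : Index → ℕ) → ∑ xs (λ x → f x * c) ≡ ∑ xs f * c
∑-*ʳ xs c f = trans (∑-cong xs (λ x → *-comm (f x) c)) (trans (∑-*ˡ xs c f) (*-comm c (∑ xs f)))

∑-swap : ∀ (xs : List Index) (ys : List Index′) (f : Index → Index′ → ℕ) →
  ∑ xs (λ x → ∑ ys (f x)) ≡ ∑ ys (λ y → ∑ xs (λ x → f x y))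
∑-swap []       ys f = sym (∑-zero ys)
∑-swap (x ∷ xs) ys f = trans (cong (∑ ys (f x) +_) (∑-swap xs ys f)) (sym (∑-+ ys (f x) _))

∑-++ : ∀ (xs ys : List Index) (f : Index → ℕ) → ∑ (xs ++ ys) f ≡ ∑ xs f + ∑ ys f
∑-++ xs ys f = trans (cong sum (map-++ f xs ys)) (sum-++ (map f xs) (map f ys))

∑-↭ : ∀ {xs ys : List Index} (f : Index → ℕ) → xs ↭ ys → ∑ xs f ≡ ∑ ys f
∑-↭ f p = sum-↭ (↭-map⁺ f p)

∑-map : ∀ (h : Index′ → Index) (xs : List Index′) (f : Index → ℕ) → ∑ (map h xs) f ≡ ∑ xs (f ∘ h)
∑-map h xs f = cong sum (sym (map-∘ xs))

∑-cartesianProduct : ∀ (xs : List Index) (ys : List Index′) (f : Index → Index′ → ℕ) →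
  ∑ (cartesianProduct xs ys) (uncurry f) ≡ ∑ xs (λ x → ∑ ys (f x))
∑-cartesianProduct []       ys f = refl
∑-cartesianProduct (x ∷ xs) ys f =
  trans (∑-++ (map (x ,_) ys) (cartesianProduct xs ys) (uncurry f))
        (cong₂ _+_ (∑-map (x ,_) ys (uncurry f)) (∑-cartesianProduct xs ys f))

term≤∑ : ∀ {xs : List Index} (f : Index → ℕ) {x} → x ∈ xs → f x ≤ ∑ xs f
term≤∑ f (here refl) = m≤m+n _ _
term≤∑ f (there x∈)  = ≤-trans (term≤∑ f x∈) (m≤n+m _ _)

∑-positive : ∀ (xs : List Index) (f : Index → ℕ) → 1 ≤ ∑ xs f → ∃[ x ] (x ∈ xs × 1 ≤ f x)
∑-positive (x ∷ xs) f 1≤ with f x in eq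
... | suc _ = x , here refl , subst (1 ≤_) (sym eq) (s≤s z≤n)
... | zero with ∑-positive xs f 1≤
...   | y , y∈ , 1≤fy = y , there y∈ , 1≤fy

-- No term exceeds 1, so a total of 2 needs two positions, and uniqueness makes their entries
-- distinct. This extracts two parents of one vertex from a count.
∑-two : ∀ (xs : List Index) (f : Index → ℕ) → Unique xs → (∀ x → f x ≤ 1) → 2 ≤ ∑ xs f →
  ∃[ y ] ∃[ z ] (y ≢ z × 1 ≤ f y × 1 ≤ f z)
∑-two (x ∷ xs) f (x∉ ∷ u) f≤1 2≤ with f x in eq
... | zero = ∑-two xs f u f≤1 2≤
... | suc (suc _) = contradiction (subst (_≤ 1) eq (f≤1 x)) λ { (s≤s ()) }
... | suc zero with ∑-positive xs f (s≤s⁻¹ 2≤)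
...   | y , y∈ , 1≤fy = x , y , All.lookup x∉ y∈ , subst (1 ≤_) (sym eq) ≤-refl , 1≤fy

-- Were one term larger than 1, the others, each at least 1, would push the sum past the length.
∑-tight : ∀ (xs : List Index) (f : Index → ℕ) → (∀ x → 1 ≤ f x) → ∑ xs f ≤ length xs → ∀ {x} → x ∈ xs → f x ≤ 1
∑-tight (y ∷ ys) f 1≤f ∑≤ (here refl) =
  +-cancelʳ-≤ (length ys) _ _ (≤-trans (+-monoʳ-≤ (f y) length≤) ∑≤)
  where
  length≤ : length ys ≤ ∑ ys f
  length≤ = subst (_≤ ∑ ys f) (*-identityʳ _) (∑-lower ys 1 (λ {x} _ → 1≤f x))
∑-tight (y ∷ ys) f 1≤f ∑≤ (there x∈) =
  ∑-tight ys f 1≤f (s≤s⁻¹ (≤-trans (+-monoˡ-≤ _ (1≤f y)) ∑≤)) x∈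

-- `zs` is the complement of `xs` in `ys`; uniqueness ensures that moving one element to the front
-- does not use up a later one.
unique-⊆⇒↭ : ∀ (xs : List Index) {ys} → Unique xs → (∀ {x} → x ∈ xs → x ∈ ys) → ∃[ zs ] (ys ↭ xs ++ zs)
unique-⊆⇒↭ []       {ys} _ _ = ys , ↭-refl
unique-⊆⇒↭ (x ∷ xs) {ys} (x∉ ∷ u) xs⊆ with ∈-∃++ (xs⊆ (here refl))
... | ps , qs , refl = proj₁ rest , ↭-trans (shift x ps qs) (prep x (proj₂ rest))
  where
  remaining : ∀ {y} → y ∈ xs → y ∈ ps ++ qs
  remaining y∈ with ∈-resp-↭ (shift x ps qs) (xs⊆ (there y∈))
  ... | here y≡x = contradiction (sym y≡x) (All.lookup x∉ y∈)
  ... | there y∈′ = y∈′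
  rest = unique-⊆⇒↭ xs u remaining

∑-unique-⊆ : ∀ (xs : List Index) {ys} (f : Index → ℕ) → Unique xs → (∀ {x} → x ∈ xs → x ∈ ys) → ∑ xs f ≤ ∑ ys f
∑-unique-⊆ xs f u xs⊆ with unique-⊆⇒↭ xs u xs⊆
... | zs , p = subst (∑ xs f ≤_) (sym (trans (∑-↭ f p) (∑-++ xs zs f))) (m≤m+n _ _)

∑-tabulate : ∀ {n} (g : Fin n → Index) (f : Index → ℕ) → ∑ (tabulate g) f ≡ ∑ (allFin n) (f ∘ g)
∑-tabulate g f = trans (cong sum (map-tabulate g f)) (sym (cong sum (map-tabulate id (f ∘ g))))

-- The tool for bounding counts such as `μ` from below: exhibiting a duplicate-free list of oriented
-- edges is enough.
∑-pairs-⊆ : ∀ {n} (f : Fin n → Fin n → ℕ) (ps : List (Fin n × Fin n)) → Unique ps →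
  ∑ ps (uncurry f) ≤ ∑ (allFin n) (λ a → ∑ (allFin n) (f a))
∑-pairs-⊆ {n} f ps u = subst (∑ ps (uncurry f) ≤_) (∑-cartesianProduct (allFin n) (allFin n) f)
  (∑-unique-⊆ ps (uncurry f) u (λ { {a , b} _ → ∈-cartesianProduct⁺ (∈-allFin a) (∈-allFin b) }))

length-allFin : ∀ n → length (allFin n) ≡ n
length-allFin n = length-tabulate id

∑-allFin-suc : ∀ {n} (f : Fin (suc n) → ℕ) → ∑ (allFin (suc n)) f ≡ f Fin.zero + ∑ (allFin n) (f ∘ Fin.suc)
∑-allFin-suc f = cong (f Fin.zero +_) (∑-tabulate Fin.suc f)

∑-allFin-+ : ∀ m {k} (f : Fin (m + k) → ℕ) →
  ∑ (allFin (m + k)) f ≡ ∑ (allFin m) (f ∘ (_↑ˡ k)) + ∑ (allFin k) (f ∘ (m ↑ʳ_))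
∑-allFin-+ zero f = refl
∑-allFin-+ (suc m) {k} f = begin
  ∑ (allFin (suc m + k)) f
    ≡⟨ ∑-allFin-suc f ⟩
  f Fin.zero + ∑ (allFin (m + k)) (f ∘ Fin.suc)
    ≡⟨ cong (f Fin.zero +_) (∑-allFin-+ m (f ∘ Fin.suc)) ⟩
  f Fin.zero + (∑ (allFin m) (f ∘ Fin.suc ∘ (_↑ˡ k)) + ∑ (allFin k) (f ∘ (suc m ↑ʳ_)))
    ≡⟨ +-assoc (f Fin.zero) _ _ ⟨
  f Fin.zero + ∑ (allFin m) (f ∘ Fin.suc ∘ (_↑ˡ k)) + ∑ (allFin k) (f ∘ (suc m ↑ʳ_))
    ≡⟨ cong (_+ ∑ (allFin k) (f ∘ (suc m ↑ʳ_))) (∑-allFin-suc (f ∘ (_↑ˡ k))) ⟨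
  ∑ (allFin (suc m)) (f ∘ (_↑ˡ k)) + ∑ (allFin k) (f ∘ (suc m ↑ʳ_)) ∎
  where open ≡-Reasoning

∑-splitAt : ∀ m {k} (f : Fin m ⊎ Fin k → ℕ) →
  ∑ (allFin (m + k)) (f ∘ splitAt m) ≡ ∑ (allFin m) (f ∘ inj₁) + ∑ (allFin k) (f ∘ inj₂)
∑-splitAt m {k} f = trans (∑-allFin-+ m (f ∘ splitAt m))
  (cong₂ _+_ (∑-cong (allFin m) (λ x → cong f (Fin.splitAt-↑ˡ m x k)))
             (∑-cong (allFin k) (λ x → cong f (Fin.splitAt-↑ʳ m k x))))

𝟙 : Bool → ℕ
𝟙 b = if b then 1 else 0

𝟙≤1 : ∀ b → 𝟙 b ≤ 1
𝟙≤1 true  = ≤-refl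
𝟙≤1 false = z≤n

𝟙+𝟙-not : ∀ b → 𝟙 b + 𝟙 (not b) ≡ 1
𝟙+𝟙-not true  = refl
𝟙+𝟙-not false = refl

𝟙-* : ∀ b k → (if b then k else 0) ≡ 𝟙 b * k
𝟙-* true  k = sym (*-identityˡ k)
𝟙-* false k = refl

<ᵇ-true : ∀ {m n} → m < n → (m <ᵇ n) ≡ true
<ᵇ-true {zero}  {suc n} _         = refl
<ᵇ-true {suc m} {suc n} (s≤s m<n) = <ᵇ-true m<n

<ᵇ-false : ∀ {m n} → n ≤ m → (m <ᵇ n) ≡ false
<ᵇ-false {m}     {zero}  _         = refl
<ᵇ-false {suc m} {suc n} (s≤s n≤m) = <ᵇ-false n≤m

<ᵇ-true⁻¹ : ∀ {m n} → (m <ᵇ n) ≡ true → m < n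
<ᵇ-true⁻¹ {m} {n} eq = <ᵇ⇒< m n (subst T (sym eq) _)

𝟙-trichotomy : ∀ {m n} → m ≢ n → 𝟙 (m <ᵇ n) + 𝟙 (n <ᵇ m) ≡ 1
𝟙-trichotomy {m} {n} m≢n with <-cmp m n
... | tri< m<n _ _ rewrite <ᵇ-true m<n | <ᵇ-false (<⇒≤ m<n) = refl

... | tri≈ _ m≡n _ = contradiction m≡n m≢n
... | tri> _ _ n<m rewrite <ᵇ-true n<m | <ᵇ-false (<⇒≤ n<m) = refl

∑-δ : ∀ {n} (r : Fin n) (f : Fin n → ℕ) → ∑ (allFin n) (λ v → 𝟙 ⌊ v Fin.≟ r ⌋ * f v) ≡ f r
∑-δ {suc n} Fin.zero f = begin
  ∑ (allFin (suc n)) (λ v → 𝟙 ⌊ v Fin.≟ Fin.zero ⌋ * f v) ≡⟨ ∑-allFin-suc (λ v → 𝟙 ⌊ v Fin.≟ Fin.zero ⌋ * f v) ⟩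
  1 * f Fin.zero + ∑ (allFin n) (λ _ → 0)                 ≡⟨ cong (f Fin.zero + 0 +_) (∑-zero (allFin n)) ⟩
  f Fin.zero + 0 + 0                                      ≡⟨ trans (+-identityʳ _) (+-identityʳ _) ⟩
  f Fin.zero ∎
  where open ≡-Reasoning
∑-δ {suc n} (Fin.suc r) f = begin
  ∑ (allFin (suc n)) (λ v → 𝟙 ⌊ v Fin.≟ Fin.suc r ⌋ * f v)       ≡⟨ ∑-allFin-suc (λ v → 𝟙 ⌊ v Fin.≟ Fin.suc r ⌋ * f v) ⟩
  ∑ (allFin n) (λ v → 𝟙 ⌊ Fin.suc v Fin.≟ Fin.suc r ⌋ * f (Fin.suc v)) ≡⟨ ∑-cong (allFin n) (λ v → cong (λ b → 𝟙 b * f (Fin.suc v)) (same v)) ⟩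
  ∑ (allFin n) (λ v → 𝟙 ⌊ v Fin.≟ r ⌋ * f (Fin.suc v))           ≡⟨ ∑-δ r (f ∘ Fin.suc) ⟩
  f (Fin.suc r) ∎
  where
  open ≡-Reasoning
  same : ∀ v → ⌊ Fin.suc v Fin.≟ Fin.suc r ⌋ ≡ ⌊ v Fin.≟ r ⌋
  same v with v Fin.≟ r
  ... | yes _ = refl
  ... | no  _ = refl

-- Passes from the sums over `toℕ u < toℕ v` in the statement to ordered pairs, where summations can
-- be exchanged freely; hence the factors 2 throughout.
∑∑≡2Σpairs : ∀ {n} (f : Fin n → Fin n → ℕ) → (∀ u v → f u v ≡ f v u) → (∀ u → f u u ≡ 0) →
  ∑ (allFin n) (λ u → ∑ (allFin n) (f u)) ≡ 2 * Σpairs f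
∑∑≡2Σpairs {n} f f-sym f-irr = begin
  ∑ V (λ u → ∑ V (f u))
    ≡⟨ ∑-cong V (λ u → ∑-cong V (split u)) ⟩
  ∑ V (λ u → ∑ V (λ v → up u v + up v u))
    ≡⟨ ∑-cong V (λ u → ∑-+ V (up u) (λ v → up v u)) ⟩
  ∑ V (λ u → ∑ V (up u) + ∑ V (λ v → up v u))
    ≡⟨ ∑-+ V _ _ ⟩
  ∑ V (λ u → ∑ V (up u)) + ∑ V (λ u → ∑ V (λ v → up v u))
    ≡⟨ cong (∑ V (λ u → ∑ V (up u)) +_) (∑-swap V V (λ u v → up v u)) ⟩
  ∑ V (λ u → ∑ V (up u)) + ∑ V (λ u → ∑ V (up u))
    ≡⟨ cong (Σpairs f +_) (+-identityʳ (Σpairs f)) ⟨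
  2 * Σpairs f ∎
  where
  open ≡-Reasoning
  V = allFin n
  up : Fin n → Fin n → ℕ
  up u v = if toℕ u <ᵇ toℕ v then f u v else 0
  split : ∀ u v → f u v ≡ up u v + up v u
  split u v with <-cmp (toℕ u) (toℕ v)
  ... | tri< u<v _ _ rewrite <ᵇ-true u<v | <ᵇ-false (<⇒≤ u<v) = sym (+-identityʳ _)
  ... | tri≈ _ u≡v _ rewrite Fin.toℕ-injective u≡v | <ᵇ-false (≤-refl {toℕ v}) = f-irr v
  ... | tri> _ _ v<u rewrite <ᵇ-true v<u | <ᵇ-false (<⇒≤ v<u) = f-sym u v

-- Metrics of graphs

-- Local conditions that determine the graph distance: `d-step` keeps it below the length of every
-- walk, and `d-pred` provides a walk of that length. Symmetry and the triangle inequality are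
-- derived.
record IsMetric (G : Graph n) (d : Fin n → Fin n → ℕ) : Set where
  field
    d-refl : ∀ u → d u u ≡ 0
    d-zero : ∀ {u v} → d u v ≡ 0 → u ≡ v
    d-step : ∀ u {w v} → adj G w v ≡ true → d u v ≤ suc (d u w)
    d-pred : ∀ {u v k} → d u v ≡ suc k → ∃[ w ] (adj G w v ≡ true × d u w ≡ k)

mutual
  -- `search` is local to `dist` and has no name here; the unnamed body is solved by unification.
  search : Graph n → Fin n → Fin n → ℕ → ℕ → ℕ
  search G u v k f = _

  dist≡search : ∀ {m} (G : Graph (suc m)) u v → dist G u v ≡ (if reach G 0 u v then 0 else search G u v 1 m)
  -- Abstracting `suc m` and `1` turns all arguments of the local search into variables, so that the
  -- unnamed body is uniquely determined.
  dist≡search {m} G u v with suc m | 1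
  ... | _ | _ = refl

-- The invariant k ≤ t ≤ k + f keeps the target in the remaining range; when f reaches 0 it forces k
-- = t, so the fallback value is right as well.
search-least : ∀ (G : Graph n) u v t → reach G t u v ≡ true → (∀ {k} → k < t → reach G k u v ≡ false) →
  ∀ k f → k ≤ t → t ≤ k + f → search G u v k f ≡ t
search-least G u v t r least k zero    k≤t t≤k = ≤-antisym k≤t (subst (t ≤_) (+-identityʳ k) t≤k)
search-least G u v t r least k (suc f) k≤t t≤k with m≤n⇒m<n∨m≡n k≤t
... | inj₁ k<t rewrite least k<t = search-least G u v t r least (suc k) f k<t (subst (t ≤_) (+-suc k f) t≤k)
... | inj₂ refl rewrite r = refl

∨-true⁻¹ : ∀ a {b} → a ∨ b ≡ true → a ≡ true ⊎ b ≡ true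
∨-true⁻¹ true  _ = inj₁ refl
∨-true⁻¹ false p = inj₂ p

∧-true⁻¹ : ∀ a {b} → a ∧ b ≡ true → a ≡ true × b ≡ true
∧-true⁻¹ true p = refl , p

module _ {n : ℕ} (G : Graph n) where

  reach-suc⁻¹ : ∀ k u v → reach G (suc k) u v ≡ true →
    reach G k u v ≡ true ⊎ (∃[ w ] (reach G k u w ≡ true × adj G w v ≡ true))
  reach-suc⁻¹ k u v r with ∨-true⁻¹ (reach G k u v) r
  ... | inj₁ r′ = inj₁ r′
  ... | inj₂ r′ with find (any⁻ _ (allFin n) (Equivalence.from T-≡ r′))
  ...   | w , _ , t = inj₂ (w , ∧-true⁻¹ (reach G k u w) (Equivalence.to T-≡ t))

  reach-step : ∀ k u {w v} → reach G k u w ≡ true → adj G w v ≡ true → reach G (suc k) u v ≡ true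
  reach-step k u {w} {v} r a = trans (cong (reach G k u v ∨_) step) (∨-zeroʳ (reach G k u v))
    where
    step : any (λ w → reach G k u w ∧ adj G w v) (allFin n) ≡ true
    step = Equivalence.to T-≡ (any⁺ (λ w → reach G k u w ∧ adj G w v)
      (lose (∈-allFin w) (Equivalence.from T-≡ (cong₂ _∧_ r a))))

  reach-weaken : ∀ k u v → reach G k u v ≡ true → reach G (suc k) u v ≡ true
  reach-weaken k u v r rewrite r = refl

  reach-zero⁻¹ : ∀ u v → reach G 0 u v ≡ true → u ≡ v
  reach-zero⁻¹ u v r with u Fin.≟ v
  ... | yes u≡v = u≡v

  reach-refl : ∀ u → reach G 0 u u ≡ true
  reach-refl u with u Fin.≟ u
  ... | yes _  = refl
  ... | no u≢u = contradiction refl u≢u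

  module MetricIsDist {d : Fin n → Fin n → ℕ} (M : IsMetric G d) where
    open IsMetric M

    reach⇒d≤ : ∀ k {u v} → reach G k u v ≡ true → d u v ≤ k
    reach⇒d≤ zero {u} {v} r with reach-zero⁻¹ u v r
    ... | refl = ≤-reflexive (d-refl u)
    reach⇒d≤ (suc k) {u} {v} r with reach-suc⁻¹ k u v r
    ... | inj₁ r′           = m≤n⇒m≤1+n (reach⇒d≤ k r′)
    ... | inj₂ (w , r′ , a) = ≤-trans (d-step u a) (s≤s (reach⇒d≤ k r′))

    d⇒reach : ∀ k {u v} → d u v ≡ k → reach G k u v ≡ true
    d⇒reach zero {u} eq with d-zero eq
    ... | refl = reach-refl u
    d⇒reach (suc k) eq with d-pred eq
    ... | w , a , eq′ = reach-step k _ (d⇒reach k eq′) a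

    connected : Connected G
    connected u v = d u v , d⇒reach (d u v) refl

    ancestor-at : ∀ {u v} i k → d u v ≡ i + k → ∃[ w ] (d u w ≡ k)
    ancestor-at {v = v} zero k eq = v , eq
    ancestor-at (suc i) k eq with d-pred eq
    ... | w , _ , eq′ = ancestor-at i k eq′

    -- A geodesic has a vertex at each of the distances 0, ..., d u v from `u`. These are distinct,
    -- which is why n rounds of search suffice.
    d<n : ∀ u v → d u v < n
    d<n u v = Fin.injective⇒≤ {f = proj₁ ∘ at} λ {i} {j} eq →
      Fin.toℕ-injective (trans (sym (proj₂ (at i))) (trans (cong (d u) eq) (proj₂ (at j))))
      where
      at : (i : Fin (suc (d u v))) → ∃[ w ] (d u w ≡ toℕ i)
      at i = ancestor-at (d u v ∸ toℕ i) (toℕ i) (sym (m∸n+n≡m (s≤s⁻¹ (Fin.toℕ<n i))))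

    dist≡d : ∀ u v → dist G u v ≡ d u v
    dist≡d u v = search-least G u v (d u v) (d⇒reach (d u v) refl) least 0 n z≤n (<⇒≤ (d<n u v))
      where
      least : ∀ {k} → k < d u v → reach G k u v ≡ false
      least {k} k<d with reach G k u v in eq
      ... | true  = contradiction (reach⇒d≤ k eq) (<⇒≱ k<d)
      ... | false = refl

  least-reach : ∀ u v k → reach G k u v ≡ true →
    ∃[ t ] (reach G t u v ≡ true × ∀ {k} → reach G k u v ≡ true → t ≤ k)
  least-reach u v zero    r = 0 , r , λ _ → z≤n
  least-reach u v (suc k) r with reach G k u v ≟ᵇ true
  ... | yes r′ = least-reach u v k r′
  ... | no ¬r  = suc k , r , λ r′ → ≰⇒> λ l≤k → ¬r (weaken l≤k r′)
    where
    weaken′ : ∀ {l k} → l ≤′ k → reach G l u v ≡ true → reach G k u v ≡ true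
    weaken′ ≤′-refl     r = r
    weaken′ (≤′-step {k} p) r = reach-weaken k u v (weaken′ p r)
    weaken : ∀ {l k} → l ≤ k → reach G l u v ≡ true → reach G k u v ≡ true
    weaken = weaken′ ∘ ≤⇒≤′

  connected⇒metric : Connected G → ∃[ d ] IsMetric G d
  connected⇒metric conn = d , record
    { d-refl = λ u → n≤0⇒n≡0 (d≤ {u} {u} {0} (reach-refl u))
    ; d-zero = λ {u} {v} eq → reach-zero⁻¹ u v (subst (λ k → reach G k u v ≡ true) eq (d-reach u v))
    ; d-step = step
    ; d-pred = pred′
    }
    where
    least = λ u v → least-reach u v (proj₁ (conn u v)) (proj₂ (conn u v))
    d : Fin n → Fin n → ℕ
    d u v = proj₁ (least u v)
    d-reach : ∀ u v → reach G (d u v) u v ≡ true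
    d-reach u v = proj₁ (proj₂ (least u v))
    d≤ : ∀ {u v k} → reach G k u v ≡ true → d u v ≤ k
    d≤ {u} {v} {k} = proj₂ (proj₂ (least u v)) {k}
    step : ∀ u {w v} → adj G w v ≡ true → d u v ≤ suc (d u w)
    step u {w} {v} a = d≤ {u} {v} {suc (d u w)} (reach-step (d u w) u (d-reach u w) a)
    pred′ : ∀ {u v k} → d u v ≡ suc k → ∃[ w ] (adj G w v ≡ true × d u w ≡ k)
    pred′ {u} {v} {k} eq with reach-suc⁻¹ k u v (subst (λ k → reach G k u v ≡ true) eq (d-reach u v))
    ... | inj₁ r           = contradiction (subst (_≤ k) eq (d≤ {u} {v} {k} r)) 1+n≰n
    ... | inj₂ (w , r , a) = w , a , ≤-antisym (d≤ {u} {w} {k} r) (s≤s⁻¹ (subst (_≤ suc (d u w)) eq (step u a)))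

  dist-isMetric : Connected G → IsMetric G (dist G)
  dist-isMetric conn with connected⇒metric conn
  ... | d , M = record
    { d-refl = λ u → trans (dist≡d u u) (d-refl u)
    ; d-zero = λ {u} {v} eq → d-zero (trans (sym (dist≡d u v)) eq)
    ; d-step = λ u {w} {v} a → subst₂ _≤_ (sym (dist≡d u v)) (cong suc (sym (dist≡d u w))) (d-step u a)
    ; d-pred = λ {u} {v} eq → let w , a , eq′ = d-pred (trans (sym (dist≡d u v)) eq)
                              in w , a , trans (dist≡d u w) eq′
    }
    where
    open IsMetric M
    open MetricIsDist M

module Metric {n : ℕ} {G : Graph n} {d : Fin n → Fin n → ℕ} (M : IsMetric G d) where
  open IsMetric M public

  adj-sym : ∀ {u v} → adj G u v ≡ true → adj G v u ≡ true
  adj-sym {u} {v} a = trans (Graph.sym G v u) a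

  adj⇒≢ : ∀ {u v} → adj G u v ≡ true → u ≢ v
  adj⇒≢ {u} a refl with trans (sym a) (irrefl G u)
  ... | ()

  d-triangle : ∀ u w v → d u v ≤ d u w + d w v
  d-triangle u w v = go (d w v) refl
    where
    go : ∀ k {v} → d w v ≡ k → d u v ≤ d u w + k
    go zero eq with d-zero eq
    ... | refl = m≤m+n _ 0
    go (suc k) eq with d-pred eq
    ... | x , a , eq′ = ≤-trans (d-step u a) (subst (suc (d u x) ≤_) (sym (+-suc (d u w) k)) (s≤s (go k eq′)))

  adj⇒d≤1 : ∀ {u v} → adj G u v ≡ true → d u v ≤ 1
  adj⇒d≤1 {u} a = ≤-trans (d-step u a) (s≤s (≤-reflexive (d-refl u)))

  d-sym : ∀ u v → d u v ≡ d v u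
  d-sym u v = ≤-antisym (half u v) (half v u)
    where
    half : ∀ v u → d v u ≤ d u v
    half v u = go (d u v) refl
      where
      go : ∀ k {v} → d u v ≡ k → d v u ≤ k
      go zero eq with d-zero eq
      ... | refl = ≤-reflexive (d-refl u)
      go (suc k) {v} eq with d-pred eq
      ... | x , a , eq′ = ≤-trans (d-triangle v x u) (+-mono-≤ (adj⇒d≤1 (adj-sym a)) (go k eq′))

  adj⇒d≡1 : ∀ {u v} → adj G u v ≡ true → d u v ≡ 1
  adj⇒d≡1 {u} {v} a with d u v in eq | adj⇒d≤1 a
  ... | zero  | _       = contradiction (d-zero eq) (adj⇒≢ a)
  ... | suc _ | s≤s z≤n = refl

  -- Makes `parent` total: the root is its own parent, and truncated subtraction lets the level
  -- formula hold there too. Only adjacency needs a positive level.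
  towards : ∀ r v → ∃[ w ] (d r w ≡ d r v ∸ 1 × (0 < d r v → adj G w v ≡ true))
  towards r v = go (d r v) refl
    where
    go : ∀ k → d r v ≡ k → ∃[ w ] (d r w ≡ k ∸ 1 × (0 < k → adj G w v ≡ true))
    go zero    eq = v , eq , λ ()
    go (suc k) eq = let w , a , eq′ = d-pred eq in w , eq′ , λ _ → a

  parent : Fin n → Fin n → Fin n
  parent r v = proj₁ (towards r v)

  d-parent : ∀ r v → d r (parent r v) ≡ d r v ∸ 1
  d-parent r v = proj₁ (proj₂ (towards r v))

  parent-adj : ∀ r v → 0 < d r v → adj G (parent r v) v ≡ true
  parent-adj r v = proj₂ (proj₂ (towards r v))

  ancestor : Fin n → Fin n → ℕ → Fin n
  ancestor r v zero    = v
  ancestor r v (suc i) = parent r (ancestor r v i)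

  d-ancestor : ∀ r v i → d r (ancestor r v i) ≡ d r v ∸ i
  d-ancestor r v zero    = refl
  d-ancestor r v (suc i) = trans (d-parent r (ancestor r v i))
    (trans (cong (_∸ 1) (d-ancestor r v i)) (trans (∸-+-assoc (d r v) i 1) (cong (d r v ∸_) (+-comm i 1))))

  ancestor-adj : ∀ r v i → i < d r v → adj G (ancestor r v (suc i)) (ancestor r v i) ≡ true
  ancestor-adj r v i i<d = parent-adj r _ (subst (0 <_) (sym (d-ancestor r v i)) (m<n⇒0<n∸m i<d))

  ancestor-root : ∀ r v → ancestor r v (d r v) ≡ r
  ancestor-root r v = sym (d-zero (trans (d-ancestor r v (d r v)) (n∸n≡0 (d r v))))

  -- The walk to the ancestor has length i; a shorter one would, by the triangle inequality, bring
  -- `v` closer to `r` than `d r v`.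
  d-from-ancestor : ∀ r v i → i ≤ d r v → d v (ancestor r v i) ≡ i
  d-from-ancestor r v i i≤d = ≤-antisym (upper i i≤d) lower
    where
    upper : ∀ i → i ≤ d r v → d v (ancestor r v i) ≤ i
    upper zero    _   = ≤-reflexive (d-refl v)
    upper (suc i) i<d = ≤-trans (d-step v (adj-sym (ancestor-adj r v i i<d))) (s≤s (upper i (<⇒≤ i<d)))
    lower : i ≤ d v (ancestor r v i)
    lower = +-cancelʳ-≤ (d r v ∸ i) i _ (begin
      i + (d r v ∸ i)                           ≡⟨ m+[n∸m]≡n i≤d ⟩
      d r v                                     ≡⟨ d-sym r v ⟩
      d v r                                     ≤⟨ d-triangle v (ancestor r v i) r ⟩
      d v (ancestor r v i) + d (ancestor r v i) r ≡⟨ cong (d v (ancestor r v i) +_) (trans (d-sym _ r) (d-ancestor r v i)) ⟩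
      d v (ancestor r v i) + (d r v ∸ i)        ∎)
      where open ≤-Reasoning

-- The form in which bipartiteness is used: seen from any root, every edge has a strictly nearer
-- end.
Graded : (G : Graph n) (d : Fin n → Fin n → ℕ) → Set
Graded G d = ∀ r {u v} → adj G u v ≡ true → d r u ≢ d r v

isOdd : ℕ → Bool
isOdd zero    = false
isOdd (suc k) = not (isOdd k)

-- Colours alternate along a geodesic, so the parity of the distance from `r` fixes the colour of a
-- vertex; equidistant ends of an edge would share theirs.
bipartite⇒graded : ∀ {G : Graph n} {d} → IsMetric G d → Bipartite G → Graded G d
bipartite⇒graded {n} {G} {d} M (c , proper) r {u} {v} a d≡ = proper u v a
  (trans (colour (d r u) refl) (trans (cong (λ k → isOdd k xor c r) d≡) (sym (colour (d r v) refl))))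
  where
  open IsMetric M
  flip : ∀ {x y} → x ≢ y → y ≡ not x
  flip {true}  {true}  x≢y = contradiction refl x≢y
  flip {true}  {false} x≢y = refl
  flip {false} {true}  x≢y = refl
  flip {false} {false} x≢y = contradiction refl x≢y
  not-xor : ∀ x y → not (x xor y) ≡ not x xor y
  not-xor true  true  = refl
  not-xor true  false = refl
  not-xor false y     = refl
  colour : ∀ k {v} → d r v ≡ k → c v ≡ isOdd k xor c r
  colour zero eq with d-zero eq
  ... | refl = refl
  colour (suc k) {v} eq with d-pred eq
  ... | w , a , eq′ = trans (flip (proper w v a)) (trans (cong not (colour k eq′)) (not-xor (isOdd k) (c r)))

-- Edges separating two vertices

module Separation {n : ℕ} (G : Graph n) (M : IsMetric G (dist G)) where
  open Metric M

  V : List (Fin n)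
  V = allFin n

  d : Fin n → Fin n → ℕ
  d = dist G

  closer : Fin n → Fin n → Fin n → ℕ
  closer a b w = 𝟙 (d a w <ᵇ d b w)

  -- The oriented edge ab separates v (on the side of a) from y (on the side of b).
  sep : Fin n → Fin n → Fin n → Fin n → ℕ
  sep v y a b = 𝟙 (adj G a b) * (closer a b v * closer b a y)

  -- Each undirected edge is counted at most once, since only one of its orientations can have `v`
  -- on the side of the first end.
  μ : Fin n → Fin n → ℕ
  μ v y = ∑ V (λ a → ∑ V (sep v y a))

  closer-true : ∀ {v a b} → d v a < d v b → closer a b v ≡ 1
  closer-true {v} {a} {b} lt =
    cong 𝟙 (<ᵇ-true (subst₂ _<_ (d-sym v a) (d-sym v b) lt))

  closer-false : ∀ {v a b} → d v b ≤ d v a → closer a b v ≡ 0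
  closer-false {v} {a} {b} le =
    cong 𝟙 (<ᵇ-false (subst₂ _≤_ (d-sym v b) (d-sym v a) le))

  sep-true : ∀ {v y a b} → adj G a b ≡ true → d v a < d v b → d y b < d y a → sep v y a b ≡ 1
  sep-true {v} {y} {a} {b} ab va yb =
    cong₂ _*_ (cong 𝟙 ab) (cong₂ _*_ (closer-true va) (closer-true yb))

  sep-swap : ∀ v y a b → sep v y a b ≡ sep y v b a
  sep-swap v y a b = cong₂ _*_ (cong 𝟙 (Graph.sym G a b)) (*-comm (closer a b v) (closer b a y))

  μ-sym : ∀ v y → μ v y ≡ μ y v
  μ-sym v y = trans (∑-cong V (λ a → ∑-cong V (sep-swap v y a))) (∑-swap V V (λ a b → sep y v b a))

  rotate : (f : Fin n → Fin n → Fin n → ℕ) →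
    ∑ V (λ a → ∑ V (λ b → ∑ V (f a b))) ≡ ∑ V (λ v → ∑ V (λ a → ∑ V (λ b → f a b v)))
  rotate f = trans (∑-cong V (λ a → ∑-swap V V (f a))) (∑-swap V V (λ a v → ∑ V (λ b → f a b v)))

  ∑∑-nClose : ∑ V (λ a → ∑ V (λ b → 𝟙 (adj G a b) * (nClose G a b * nClose G b a))) ≡ 2 * Sz G
  ∑∑-nClose = trans (∑-cong V (λ a → ∑-cong V (λ b → sym (𝟙-* (adj G a b) _))))
    (∑∑≡2Σpairs term term-sym (λ u → cong (if_then nClose G u u * nClose G u u else 0) (irrefl G u)))
    where
    term : Fin n → Fin n → ℕ
    term u v = if adj G u v then nClose G u v * nClose G v u else 0
    term-sym : ∀ u v → term u v ≡ term v u
    term-sym u v = cong₂ (λ c k → if c then k else 0) (Graph.sym G u v) (*-comm (nClose G u v) (nClose G v u))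

  ∑∑-dist : ∑ V (λ u → ∑ V (d u)) ≡ 2 * W G
  ∑∑-dist = ∑∑≡2Σpairs d d-sym d-refl

  ∑∑-μ : ∑ V (λ v → ∑ V (μ v)) ≡ 2 * Sz G
  ∑∑-μ = trans (sym (begin
    ∑ V (λ a → ∑ V (λ b → 𝟙 (adj G a b) * (nClose G a b * nClose G b a)))
      ≡⟨ ∑-cong V (λ a → ∑-cong V (λ b → expand a b)) ⟩
    ∑ V (λ a → ∑ V (λ b → ∑ V (λ v → ∑ V (λ y → sep v y a b))))
      ≡⟨ rotate (λ a b v → ∑ V (λ y → sep v y a b)) ⟩
    ∑ V (λ v → ∑ V (λ a → ∑ V (λ b → ∑ V (λ y → sep v y a b))))
      ≡⟨ ∑-cong V (λ v → rotate (λ a b y → sep v y a b)) ⟩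
    ∑ V (λ v → ∑ V (μ v)) ∎)) ∑∑-nClose
    where
    open ≡-Reasoning
    expand : ∀ a b → 𝟙 (adj G a b) * (nClose G a b * nClose G b a) ≡ ∑ V (λ v → ∑ V (λ y → sep v y a b))
    expand a b = sym (begin
      ∑ V (λ v → ∑ V (λ y → e * (closer a b v * closer b a y)))
        ≡⟨ ∑-cong V (λ v → trans (∑-*ˡ V e _) (cong (e *_) (∑-*ˡ V (closer a b v) (closer b a)))) ⟩
      ∑ V (λ v → e * (closer a b v * nClose G b a))
        ≡⟨ ∑-*ˡ V e (λ v → closer a b v * nClose G b a) ⟩
      e * ∑ V (λ v → closer a b v * nClose G b a)
        ≡⟨ cong (e *_) (∑-*ʳ V (nClose G b a) (closer a b)) ⟩
      e * (nClose G a b * nClose G b a) ∎)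
      where e = 𝟙 (adj G a b)

  near : ℕ → Fin n → Fin n → Bool
  near m v a = d v a <ᵇ m

  -- Each level i < m contributes the edge of a geodesic from v to y between levels i and i + 1.
  near-edges : ∀ v y m → m ≤ d v y → m ≤ ∑ V (λ a → ∑ V (λ b → sep v y a b * 𝟙 (near m v a)))
  near-edges v y m m≤L = begin
    m                                                  ≡⟨ trans (*-identityʳ _) (length-applyUpTo e m) ⟨
    length es * 1                                      ≤⟨ ∑-lower es 1 counted ⟩
    ∑ es (uncurry (λ a b → sep v y a b * 𝟙 (near m v a))) ≤⟨ ∑-pairs-⊆ _ es (applyUpTo⁺₁ e m distinct) ⟩
    ∑ V (λ a → ∑ V (λ b → sep v y a b * 𝟙 (near m v a))) ∎
    where
    open ≤-Reasoning
    L = d v y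
    -- `ancestor v y` starts at `y`, so `L ∸ i` steps lead to the vertex at distance i from `v`, and
    -- `e i` points away from `v`.
    e : ℕ → Fin n × Fin n
    e i = ancestor v y (L ∸ i) , ancestor v y (L ∸ suc i)
    es = applyUpTo e m
    level : ∀ i → i ≤ L → d v (ancestor v y (L ∸ i)) ≡ i
    level i i≤L = trans (d-ancestor v y (L ∸ i)) (m∸[m∸n]≡n i≤L)
    height : ∀ i → d y (ancestor v y (L ∸ i)) ≡ L ∸ i
    height i = d-from-ancestor v y (L ∸ i) (m∸n≤m L i)
    distinct : ∀ {i j} → i < j → j < m → e i ≢ e j
    distinct {i} {j} i<j j<m eq = <⇒≢ i<j (trans (sym (level i (≤-trans (<⇒≤ (<-trans i<j j<m)) m≤L)))
      (trans (cong (d v ∘ proj₁) eq) (level j (≤-trans (<⇒≤ j<m) m≤L))))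
    counted : ∀ {p} → p ∈ es → 1 ≤ uncurry (λ a b → sep v y a b * 𝟙 (near m v a)) p
    counted p∈ with ∈-applyUpTo⁻ e p∈
    ... | i , i<m , refl = ≤-reflexive (sym (cong₂ _*_ (sep-true edge near-v near-y) (cong 𝟙 (<ᵇ-true low))))
      where
      i<L = ≤-trans i<m m≤L
      step : suc (L ∸ suc i) ≡ L ∸ i
      step = sym (+-∸-assoc 1 i<L)
      edge : adj G (ancestor v y (L ∸ i)) (ancestor v y (L ∸ suc i)) ≡ true
      edge = subst (λ k → adj G (ancestor v y k) (ancestor v y (L ∸ suc i)) ≡ true) step
        (ancestor-adj v y (L ∸ suc i) (subst (_≤ L) (sym step) (m∸n≤m L i)))
      near-v : d v (ancestor v y (L ∸ i)) < d v (ancestor v y (L ∸ suc i))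
      near-v = subst₂ _<_ (sym (level i (<⇒≤ i<L))) (sym (level (suc i) i<L)) ≤-refl
      near-y : d y (ancestor v y (L ∸ suc i)) < d y (ancestor v y (L ∸ i))
      near-y = subst₂ _<_ (sym (height (suc i))) (sym (height i)) (≤-reflexive step)
      low : d v (ancestor v y (L ∸ i)) < m
      low = subst (_< m) (sym (level i (<⇒≤ i<L))) i<m

  μ-split : ∀ v y m → μ v y ≡ ∑ V (λ a → ∑ V (λ b → sep v y a b * 𝟙 (near m v a)))
                            + ∑ V (λ a → ∑ V (λ b → sep v y a b * 𝟙 (not (near m v a))))
  μ-split v y m = trans (∑-cong V (λ a → trans (∑-cong V (split a)) (∑-+ V _ _))) (∑-+ V _ _)
    where
    split : ∀ a b → sep v y a b ≡ sep v y a b * 𝟙 (near m v a) + sep v y a b * 𝟙 (not (near m v a))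
    split a b = trans (sym (*-identityʳ _)) (trans (cong (sep v y a b *_) (sym (𝟙+𝟙-not (near m v a))))
      (*-distribˡ-+ (sep v y a b) _ _))

  d≤μ : ∀ v y → d v y ≤ μ v y
  d≤μ v y = ≤-trans (near-edges v y (d v y) ≤-refl)
    (subst (∑ V (λ a → ∑ V (λ b → sep v y a b * 𝟙 (near (d v y) v a))) ≤_) (sym (μ-split v y (d v y))) (m≤m+n _ _))

  -- If the pairs {v, x} with x in L have total excess μ − d at least 4 for every v, then
  -- 2 (Sz − W) is at least 4 n (pairs meeting L on the right) plus 4 (n − |L|) (on the left only).
  excess : ∀ (L : List (Fin n)) → Unique L → length L ≤ 4 →
    (∀ v → ∑ L (d v) + 4 ≤ ∑ L (μ v)) → W G + (4 * n ∸ 8) ≤ Sz G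
  excess L uL |L|≤4 rich with unique-⊆⇒↭ L uL (λ {x} _ → ∈-allFin x)
  ... | R , V↭ = *-cancelˡ-≤ 2 (begin
    2 * (W G + (4 * n ∸ 8))
      ≡⟨ *-distribˡ-+ 2 (W G) (4 * n ∸ 8) ⟩
    2 * W G + 2 * (4 * n ∸ 8)
      ≤⟨ +-monoʳ-≤ (2 * W G) numeric ⟩
    2 * W G + (n * 4 + length R * 4)
      ≤⟨ +-monoʳ-≤ (2 * W G) total-δ ⟩
    2 * W G + ∑ V (λ v → ∑ V (δ v))
      ≡⟨ cong (_+ ∑ V (λ v → ∑ V (δ v))) ∑∑-dist ⟨
    ∑ V (λ v → ∑ V (d v)) + ∑ V (λ v → ∑ V (δ v))
      ≡⟨ ∑-+ V _ _ ⟨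
    ∑ V (λ v → ∑ V (d v) + ∑ V (δ v))
      ≡⟨ ∑-cong V (λ v → trans (sym (∑-+ V (d v) (δ v))) (∑-cong V (λ x → m+[n∸m]≡n (d≤μ v x)))) ⟩
    ∑ V (λ v → ∑ V (μ v))
      ≡⟨ ∑∑-μ ⟩
    2 * Sz G ∎)
    where
    open ≤-Reasoning
    δ : Fin n → Fin n → ℕ
    δ v x = μ v x ∸ d v x
    δ-sym : ∀ v x → δ v x ≡ δ x v
    δ-sym v x = cong₂ _∸_ (μ-sym v x) (d-sym v x)
    rich-δ : ∀ v → 4 ≤ ∑ L (δ v)
    rich-δ v = +-cancelˡ-≤ (∑ L (d v)) 4 (∑ L (δ v)) (≤-trans (rich v) (≤-reflexive
      (trans (sym (∑-cong L (λ x → m+[n∸m]≡n (d≤μ v x)))) (∑-+ L (d v) (δ v)))))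
    sizes : length L + length R ≡ n
    sizes = trans (sym (length-++ L)) (trans (sym (↭-length V↭)) (length-allFin n))
    total-δ : n * 4 + length R * 4 ≤ ∑ V (λ v → ∑ V (δ v))
    total-δ = begin
      n * 4 + length R * 4
        ≤⟨ +-mono-≤ (subst (λ k → k * 4 ≤ ∑ V (λ v → ∑ L (δ v))) (length-allFin n) (∑-lower V 4 (λ {v} _ → rich-δ v)))
                    (∑-lower R 4 (λ {x} _ → column x)) ⟩
      ∑ V (λ v → ∑ L (δ v)) + ∑ R (λ x → ∑ V (λ v → δ v x))
        ≡⟨ cong (∑ V (λ v → ∑ L (δ v)) +_) (∑-swap V R δ) ⟨
      ∑ V (λ v → ∑ L (δ v)) + ∑ V (λ v → ∑ R (δ v))
        ≡⟨ ∑-+ V _ _ ⟨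
      ∑ V (λ v → ∑ L (δ v) + ∑ R (δ v))
        ≡⟨ ∑-cong V (λ v → trans (∑-↭ (δ v) V↭) (∑-++ L R (δ v))) ⟨
      ∑ V (λ v → ∑ V (δ v)) ∎
      where
      -- By symmetry a column of `δ` is also a row, and its entries with `v` in `L` already total 4.
      column : ∀ x → 4 ≤ ∑ V (λ v → δ v x)
      column x = ≤-trans (subst (4 ≤_) (∑-cong L (λ v → δ-sym x v)) (rich-δ x))
        (∑-unique-⊆ L (λ v → δ v x) uL (λ {y} _ → ∈-allFin y))
    numeric : 2 * (4 * n ∸ 8) ≤ n * 4 + length R * 4
    numeric = begin
      2 * (4 * n ∸ 8)          ≡⟨ *-distribˡ-∸ 2 (4 * n) 8 ⟩
      2 * (4 * n) ∸ 16         ≤⟨ ∸-monoˡ-≤ 16 bound ⟩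
      n * 4 + length R * 4 + 16 ∸ 16 ≡⟨ m+n∸n≡m (n * 4 + length R * 4) 16 ⟩
      n * 4 + length R * 4     ∎
      where
      double : ∀ k → 2 * (4 * k) ≡ k * 4 + k * 4
      double = solve-∀
      regroup : ∀ k l r → k * 4 + (l + r) * 4 ≡ k * 4 + r * 4 + l * 4
      regroup = solve-∀
      -- The 16 is 4 · 4: each of the at most four columns in `L` lacks the second contribution of
      -- 4.
      bound : 2 * (4 * n) ≤ n * 4 + length R * 4 + 16
      bound = begin
        2 * (4 * n)                              ≡⟨ double n ⟩
        n * 4 + n * 4                            ≡⟨ cong (λ k → n * 4 + k * 4) sizes ⟨
        n * 4 + (length L + length R) * 4        ≡⟨ regroup n (length L) (length R) ⟩
        n * 4 + length R * 4 + length L * 4      ≤⟨ +-monoʳ-≤ (n * 4 + length R * 4) (*-monoˡ-≤ 4 |L|≤4) ⟩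
        n * 4 + length R * 4 + 16                ∎

-- Cycles through two antipodes

minimum-upTo : ∀ (f : ℕ → ℕ) p → ∃[ k ] (k ≤ p × (∀ {j} → j ≤ p → f k ≤ f j))
minimum-upTo f zero = 0 , z≤n , λ { z≤n → ≤-refl }
minimum-upTo f (suc p) with minimum-upTo f p
... | k , k≤p , min with ≤-total (f k) (f (suc p))
...   | inj₁ fk≤ = k , m≤n⇒m≤1+n k≤p , λ j≤ → [ min ∘ s≤s⁻¹ , (λ { refl → fk≤ }) ]′ (m≤n⇒m<n∨m≡n j≤)
...   | inj₂ ≤fk = suc p , ≤-refl , λ j≤ → [ ≤-trans ≤fk ∘ min ∘ s≤s⁻¹ , (λ { refl → ≤-refl }) ]′ (m≤n⇒m<n∨m≡n j≤)

module LowerBound {n : ℕ} (G : Graph n) (M : IsMetric G (dist G)) (graded : Graded G (dist G)) where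
  open Metric M
  open Separation G M

  -- A walk as long as the distance of its ends; only the values of `A` up to p matter. All
  -- intermediate distances are then exact, because the upper bounds from the two ends add up to p.
  record Geodesic (x r : Fin n) (p : ℕ) (A : ℕ → Fin n) : Set where
    field
      start : A 0 ≡ x
      end   : A p ≡ r
      edge  : ∀ {k} → k < p → adj G (A k) (A (suc k)) ≡ true
      dist≡ : d x r ≡ p

    d-start≤ : ∀ k → k ≤ p → d x (A k) ≤ k
    d-start≤ zero    _   = ≤-reflexive (trans (cong (d x) start) (d-refl x))
    d-start≤ (suc k) k<p = ≤-trans (d-step x (edge k<p)) (s≤s (d-start≤ k (<⇒≤ k<p)))

    d-end≤ : ∀ i k → i + k ≡ p → d r (A k) ≤ i
    d-end≤ zero    k refl = ≤-reflexive (trans (cong (d r) end) (d-refl r))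
    d-end≤ (suc i) k eq   = ≤-trans (d-step r (adj-sym (edge (subst (suc k ≤_) eq (s≤s (m≤n+m k i))))))
      (s≤s (d-end≤ i (suc k) (trans (+-suc i k) eq)))

    private
      through : ∀ k → p ≤ d x (A k) + d r (A k)
      through k = subst₂ _≤_ dist≡ (cong (d x (A k) +_) (d-sym (A k) r)) (d-triangle x (A k) r)

    d-start : ∀ {k} → k ≤ p → d x (A k) ≡ k
    d-start {k} k≤p = ≤-antisym (d-start≤ k k≤p) (+-cancelʳ-≤ (p ∸ k) k _ (begin
      k + (p ∸ k)               ≡⟨ m+[n∸m]≡n k≤p ⟩
      p                         ≤⟨ through k ⟩
      d x (A k) + d r (A k)     ≤⟨ +-monoʳ-≤ _ (d-end≤ (p ∸ k) k (m∸n+n≡m k≤p)) ⟩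
      d x (A k) + (p ∸ k)       ∎))
      where open ≤-Reasoning

    d-end : ∀ {k} → k ≤ p → d r (A k) ≡ p ∸ k
    d-end {k} k≤p = ≤-antisym (d-end≤ (p ∸ k) k (m∸n+n≡m k≤p)) (+-cancelˡ-≤ k _ _ (begin
      k + (p ∸ k)               ≡⟨ m+[n∸m]≡n k≤p ⟩
      p                         ≤⟨ through k ⟩
      d x (A k) + d r (A k)     ≤⟨ +-monoˡ-≤ _ (d-start≤ k k≤p) ⟩
      k + d r (A k)             ∎))
      where open ≤-Reasoning

  -- Two internally disjoint geodesics, i.e. a cycle of length 2p through the antipodes x and r.
  record Theta (x r : Fin n) (p : ℕ) : Set where
    field
      A B      : ℕ → Fin n
      geoA     : Geodesic x r p A
      geoB     : Geodesic x r p B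
      disjoint : ∀ {k} → 0 < k → k < p → A k ≢ B k
      2≤p      : 2 ≤ p

  module _ {x r : Fin n} {p : ℕ} (θ : Theta x r p) where
    open Theta θ
    private
      module A = Geodesic geoA
      module B = Geodesic geoB

    cycle : List (Fin n × Fin n)
    cycle = applyUpTo (λ k → A k , A (suc k)) p ++ applyUpTo (λ k → B k , B (suc k)) p

    -- Positions on either path are told apart by their distance from `x`, so a common edge occupies
    -- the same position k on both. One of its ends is then a common interior vertex: the second if
    -- k = 0, which needs 2 ≤ p, and the first otherwise.
    cycle-unique : Unique cycle
    cycle-unique = ++⁺ (distinct geoA) (distinct geoB) λ { (∈A , ∈B) → apart ∈A ∈B }
      where
      distinct : ∀ {A} → Geodesic x r p A → Unique (applyUpTo (λ k → A k , A (suc k)) p)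
      distinct g = applyUpTo⁺₁ _ p λ {i} {j} i<j j<p eq → <⇒≢ i<j
        (trans (sym (Geodesic.d-start g (<⇒≤ (<-trans i<j j<p))))
               (trans (cong (d x ∘ proj₁) eq) (Geodesic.d-start g (<⇒≤ j<p))))
      meet : ∀ k → k < p → A k ≡ B k → A (suc k) ≢ B (suc k)
      meet zero    k<p _  = disjoint (s≤s z≤n) 2≤p
      meet (suc k) k<p eq = contradiction eq (disjoint (s≤s z≤n) k<p)
      apart : ∀ {e} → e ∈ applyUpTo (λ k → A k , A (suc k)) p → e ∈ applyUpTo (λ k → B k , B (suc k)) p → _
      apart ∈A ∈B with ∈-applyUpTo⁻ _ ∈A | ∈-applyUpTo⁻ _ ∈B
      ... | i , i<p , refl | j , j<p , eq with trans (sym (A.d-start (<⇒≤ i<p))) (trans (cong (d x ∘ proj₁) eq) (B.d-start (<⇒≤ j<p)))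
      ...   | refl = meet i i<p (cong proj₁ eq) (cong proj₂ eq)

    -- Each of the 2p edges of the cycle separates v from exactly one of x and r; with m the distance
    -- from v to the cycle, near-edges adds m for each of x and r, and d v x + d v r ≤ 2m + p.
    theta-excess : ∀ v → d v x + d v r + p ≤ μ v x + μ v r
    theta-excess v with minimum-upTo (λ k → d v (A k) ⊓ d v (B k)) p
    ... | k , k≤p , min = begin
      d v x + d v r + p
        ≤⟨ +-monoˡ-≤ p d-bound ⟩
      m + m + p + p
        ≡⟨ regroup m p ⟩
      m + (m + (p + p) * 1)
        ≤⟨ +-mono-≤ (near-edges v x m m≤x) (+-mono-≤ (near-edges v r m m≤r) cycle-count) ⟩
      lo x + (lo r + (hi r + hi x))
        ≡⟨ shuffle (lo x) (lo r) (hi r) (hi x) ⟩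
      (lo x + hi x) + (lo r + hi r)
        ≡⟨ cong₂ _+_ (μ-split v x m) (μ-split v r m) ⟨
      μ v x + μ v r ∎
      where
      open ≤-Reasoning
      m = d v (A k) ⊓ d v (B k)
      far : Fin n → ℕ
      far a = 𝟙 (not (near m v a))
      lo hi : Fin n → ℕ
      lo y = ∑ V (λ a → ∑ V (λ b → sep v y a b * 𝟙 (near m v a)))
      hi y = ∑ V (λ a → ∑ V (λ b → sep v y a b * far a))
      regroup : ∀ m p → m + m + p + p ≡ m + (m + (p + p) * 1)
      regroup = solve-∀
      shuffle : ∀ a b c e → a + (b + (c + e)) ≡ (a + e) + (b + c)
      shuffle = solve-∀
      m≤A : ∀ {j} → j ≤ p → m ≤ d v (A j)
      m≤A j≤p = ≤-trans (min j≤p) (m⊓n≤m _ _)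
      m≤B : ∀ {j} → j ≤ p → m ≤ d v (B j)
      m≤B j≤p = ≤-trans (min j≤p) (m⊓n≤n _ _)
      m≤x : m ≤ d v x
      m≤x = subst (λ y → m ≤ d v y) A.start (m≤A z≤n)
      m≤r : m ≤ d v r
      m≤r = subst (λ y → m ≤ d v y) A.end (m≤A ≤-refl)
      -- Both distances are routed through a vertex `w` of the cycle nearest to `v`; lying on a
      -- geodesic from `x` to `r`, it adds exactly p.
      via : ∀ w → d v w ≡ m → d x w ≡ k → d r w ≡ p ∸ k → d v x + d v r ≤ m + m + p
      via w vw xw rw = begin
        d v x + d v r                     ≤⟨ +-mono-≤ (d-triangle v w x) (d-triangle v w r) ⟩
        (d v w + d w x) + (d v w + d w r) ≡⟨ cong₂ _+_ (cong₂ _+_ vw (trans (d-sym w x) xw)) (cong₂ _+_ vw (trans (d-sym w r) rw)) ⟩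
        (m + k) + (m + (p ∸ k))           ≡⟨ swap m k (p ∸ k) ⟩
        m + m + (k + (p ∸ k))             ≡⟨ cong (m + m +_) (m+[n∸m]≡n k≤p) ⟩
        m + m + p                         ∎
        where
        swap : ∀ m k l → (m + k) + (m + l) ≡ m + m + (k + l)
        swap = solve-∀
      d-bound : d v x + d v r ≤ m + m + p
      d-bound with ⊓-sel (d v (A k)) (d v (B k))
      ... | inj₁ eq = via (A k) (sym eq) (A.d-start k≤p) (A.d-end k≤p)
      ... | inj₂ eq = via (B k) (sym eq) (B.d-start k≤p) (B.d-end k≤p)
      -- Cycle edges are listed from `x` towards `r`. If `v` is nearer to the first end, the edge
      -- separates `v` from `r`; otherwise the reversed edge separates `v` from `x`. The factor
      -- `far` tests the nearer end, at distance at least m, so none of these edges is among the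
      -- `near` ones.
      weight : Fin n → Fin n → ℕ
      weight a b = sep v r a b * far a + sep v x b a * far b
      hi-weight : ∑ V (λ a → ∑ V (weight a)) ≡ hi r + hi x
      hi-weight = trans (∑-cong V (λ a → ∑-+ V _ _)) (trans (∑-+ V _ _)
        (cong (hi r +_) (∑-swap V V (λ a b → sep v x b a * far b))))
      far-true : ∀ {a} → m ≤ d v a → far a ≡ 1
      far-true m≤ = cong (𝟙 ∘ not) (<ᵇ-false m≤)
      weight≥1 : ∀ {C} → Geodesic x r p C → (∀ {j} → j ≤ p → m ≤ d v (C j)) →
        ∀ {j} → j < p → 1 ≤ weight (C j) (C (suc j))
      weight≥1 {C} g m≤C {j} j<p with <-cmp (d v (C j)) (d v (C (suc j)))
      ... | tri< v< _ _ = ≤-trans (≤-reflexive (sym (cong₂ _*_ (sep-true (Geodesic.edge g j<p) v< r<) (far-true (m≤C (<⇒≤ j<p)))))) (m≤m+n _ _)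
        where
        r< : d r (C (suc j)) < d r (C j)
        r< = subst₂ _<_ (sym (Geodesic.d-end g j<p)) (sym (Geodesic.d-end g (<⇒≤ j<p))) (∸-monoʳ-< ≤-refl j<p)
      ... | tri≈ _ eq _ = contradiction eq (graded v (Geodesic.edge g j<p))
      ... | tri> _ _ v> = ≤-trans (≤-reflexive (sym (cong₂ _*_ (sep-true (adj-sym (Geodesic.edge g j<p)) v> x<) (far-true (m≤C j<p))))) (m≤n+m _ _)
        where
        x< : d x (C j) < d x (C (suc j))
        x< = subst₂ _<_ (sym (Geodesic.d-start g (<⇒≤ j<p))) (sym (Geodesic.d-start g j<p)) ≤-refl
      each : ∀ {e} → e ∈ cycle → 1 ≤ uncurry weight e
      each e∈ with ∈-++⁻ (applyUpTo (λ k → A k , A (suc k)) p) e∈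
      ... | inj₁ ∈A with ∈-applyUpTo⁻ _ ∈A
      ...   | j , j<p , refl = weight≥1 geoA m≤A j<p
      each e∈ | inj₂ ∈B with ∈-applyUpTo⁻ _ ∈B
      ...   | j , j<p , refl = weight≥1 geoB m≤B j<p
      cycle-length : length cycle ≡ p + p
      cycle-length = trans (length-++ (applyUpTo (λ k → A k , A (suc k)) p))
        (cong₂ _+_ (length-applyUpTo _ p) (length-applyUpTo _ p))
      cycle-count : (p + p) * 1 ≤ hi r + hi x
      cycle-count = subst₂ _≤_ (cong (_* 1) cycle-length) hi-weight
        (≤-trans (∑-lower cycle 1 each) (∑-pairs-⊆ weight cycle cycle-unique))

  Goal : Set
  Goal = W G + (4 * n ∸ 8) ≤ Sz G

  long-theta : ∀ {x r p} → 4 ≤ p → Theta x r p → Goal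
  long-theta {x} {r} {p} 4≤p θ = excess (x ∷ r ∷ []) ((x≢r ∷ []) ∷ [] ∷ []) (s≤s (s≤s z≤n)) λ v → begin
    d v x + (d v r + 0) + 4 ≡⟨ cong (λ k → d v x + k + 4) (+-identityʳ _) ⟩
    d v x + d v r + 4       ≤⟨ +-monoʳ-≤ _ 4≤p ⟩
    d v x + d v r + p       ≤⟨ theta-excess θ v ⟩
    μ v x + μ v r           ≡⟨ cong (μ v x +_) (+-identityʳ _) ⟨
    μ v x + (μ v r + 0)     ∎
    where
    open ≤-Reasoning
    x≢r : x ≢ r
    x≢r refl = contradiction (subst (4 ≤_) (trans (sym (Geodesic.dist≡ (Theta.geoA θ))) (d-refl x)) 4≤p) λ ()

  -- Each pair contributes p ≥ 2, together at least 4, and four vertices are exactly what `excess`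
  -- admits.
  two-thetas : ∀ {x r y z p} → Unique (x ∷ r ∷ y ∷ z ∷ []) → Theta x r p → Theta y z p → Goal
  two-thetas {x} {r} {y} {z} {p} u θ φ = excess (x ∷ r ∷ y ∷ z ∷ []) u ≤-refl λ v → begin
    d v x + (d v r + (d v y + (d v z + 0))) + 4 ≡⟨ regroup (d v x) (d v r) (d v y) (d v z) 2 ⟩
    (d v x + d v r + 2) + (d v y + d v z + 2)   ≤⟨ +-mono-≤ (+-monoʳ-≤ (d v x + d v r) (Theta.2≤p θ)) (+-monoʳ-≤ (d v y + d v z) (Theta.2≤p φ)) ⟩
    (d v x + d v r + p) + (d v y + d v z + p)   ≤⟨ +-mono-≤ (theta-excess θ v) (theta-excess φ v) ⟩
    (μ v x + μ v r) + (μ v y + μ v z)           ≡⟨ regroup′ (μ v x) (μ v r) (μ v y) (μ v z) ⟩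
    μ v x + (μ v r + (μ v y + (μ v z + 0)))     ∎
    where
    open ≤-Reasoning
    regroup : ∀ a b c e k → a + (b + (c + (e + 0))) + (k + k) ≡ (a + b + k) + (c + e + k)
    regroup = solve-∀
    regroup′ : ∀ a b c e → (a + b) + (c + e) ≡ a + (b + (c + (e + 0)))
    regroup′ = solve-∀

  -- The common neighbour gives at most 2, and distance 1 would put the adjacent vertices `x` and
  -- `z` on one level around `y`.
  same-side⇒d≡2 : ∀ {x y z} → y ≢ z → adj G x y ≡ true → adj G x z ≡ true → d y z ≡ 2
  same-side⇒d≡2 {x} {y} {z} y≢z xy xz with d y z in eq | ≤-trans (d-triangle y x z) (+-mono-≤ (adj⇒d≤1 (adj-sym xy)) (adj⇒d≤1 xz))
  ... | 0 | _ = contradiction (d-zero eq) y≢z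
  ... | 1 | _ = contradiction (trans eq (sym (adj⇒d≡1 (adj-sym xy)))) (≢-sym (graded y xz))
  ... | 2 | _ = refl
  ... | suc (suc (suc _)) | s≤s (s≤s ())

  theta-square : ∀ {x r y z} → d x r ≡ 2 → y ≢ z → adj G x y ≡ true → adj G y r ≡ true →
    adj G x z ≡ true → adj G z r ≡ true → Theta x r 2
  theta-square {x} {r} {y} {z} xr y≢z xy yr xz zr = record
    { A = via y ; B = via z ; geoA = geo xy yr ; geoB = geo xz zr
    ; disjoint = λ { {1} _ _ → y≢z ; {suc (suc _)} _ (s≤s (s≤s ())) } ; 2≤p = ≤-refl }
    where
    via : Fin n → ℕ → Fin n
    via w 0 = x
    via w 1 = w
    via w (suc (suc _)) = r
    geo : ∀ {w} → adj G x w ≡ true → adj G w r ≡ true → Geodesic x r 2 (via w)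
    geo xw wr = record { start = refl ; end = refl ; dist≡ = xr
      ; edge = λ { {0} _ → xw ; {1} _ → wr ; {suc (suc _)} (s≤s (s≤s ())) } }

  -- Both diagonals of a 4-cycle are antipodal pairs: `x`, `r` and `y`, `z` may exchange roles.
  square : ∀ {x y r z} → x ≢ r → y ≢ z → adj G x y ≡ true → adj G y r ≡ true →
    adj G x z ≡ true → adj G z r ≡ true → Goal
  square {x} {y} {r} {z} x≢r y≢z xy yr xz zr = two-thetas
    ((x≢r ∷ adj⇒≢ xy ∷ adj⇒≢ xz ∷ []) ∷ (≢-sym (adj⇒≢ yr) ∷ ≢-sym (adj⇒≢ zr) ∷ []) ∷ (y≢z ∷ []) ∷ [] ∷ [])
    (theta-square (same-side⇒d≡2 x≢r (adj-sym xy) yr) y≢z xy yr xz zr)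
    (theta-square (same-side⇒d≡2 y≢z xy xz) x≢r (adj-sym xy) xz yr (adj-sym zr))

  short-theta : ∀ {x r} → Theta x r 2 → Goal
  short-theta {x} {r} θ = square x≢r (disjoint (s≤s z≤n) ≤-refl)
    (subst (λ u → adj G u (A 1) ≡ true) A.start (A.edge (s≤s z≤n)))
    (subst (λ u → adj G (A 1) u ≡ true) A.end (A.edge ≤-refl))
    (subst (λ u → adj G u (B 1) ≡ true) B.start (B.edge (s≤s z≤n)))
    (subst (λ u → adj G (B 1) u ≡ true) B.end (B.edge ≤-refl))
    where
    open Theta θ
    module A = Geodesic geoA
    module B = Geodesic geoB
    x≢r : x ≢ r
    x≢r refl = contradiction (trans (sym A.dist≡) (d-refl x)) λ ()

  -- In a hexagon x a₁ a₂ r b₂ b₁ either a₁b₂ is a chord, which closes a 4-cycle,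
  -- or a₁, b₂ form a second antipodal pair.
  hexagon : ∀ {x r} → Theta x r 3 → Goal
  hexagon {x} {r} θ with adj G (A 1) (B 2) in a₁b₂
    where open Theta θ
  ... | true = square {x} {A 1} {B 2} {B 1} (λ { eq → contradiction (trans (sym (d-refl x)) (trans (cong (d x) eq) (B.d-start {2} (s≤s (s≤s z≤n))))) λ () })
      (disjoint (s≤s z≤n) (s≤s (s≤s z≤n))) xa₁ a₁b₂ xb₁ (B.edge (s≤s (s≤s z≤n)))
    where
    open Theta θ
    module A = Geodesic geoA
    module B = Geodesic geoB
    xa₁ = subst (λ u → adj G u (A 1) ≡ true) A.start (A.edge (s≤s z≤n))
    xb₁ = subst (λ u → adj G u (B 1) ≡ true) B.start (B.edge (s≤s z≤n))
  ... | false = two-thetas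
      ((x≢r ∷ adj⇒≢ xa₁ ∷ x≢b₂ ∷ []) ∷ (r≢a₁ ∷ ≢-sym (adj⇒≢ b₂r) ∷ []) ∷ (a₁≢b₂ ∷ []) ∷ [] ∷ []) θ φ
    where
    open Theta θ
    module A = Geodesic geoA
    module B = Geodesic geoB
    xa₁ = subst (λ u → adj G u (A 1) ≡ true) A.start (A.edge (s≤s z≤n))
    xb₁ = subst (λ u → adj G u (B 1) ≡ true) B.start (B.edge (s≤s z≤n))
    a₁a₂ : adj G (A 1) (A 2) ≡ true
    a₁a₂ = A.edge (s≤s (s≤s z≤n))
    b₁b₂ : adj G (B 1) (B 2) ≡ true
    b₁b₂ = B.edge (s≤s (s≤s z≤n))
    a₂r = subst (λ u → adj G (A 2) u ≡ true) A.end (A.edge ≤-refl)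
    b₂r = subst (λ u → adj G (B 2) u ≡ true) B.end (B.edge ≤-refl)
    levels : ∀ {u w i j} → d x u ≡ i → d x w ≡ j → i ≢ j → u ≢ w
    levels xu xw i≢j refl = i≢j (trans (sym xu) xw)
    x≢r : x ≢ r
    x≢r = levels (d-refl x) A.dist≡ λ ()
    x≢b₂ : x ≢ B 2
    x≢b₂ = levels (d-refl x) (B.d-start {2} (s≤s (s≤s z≤n))) λ ()
    r≢a₁ : r ≢ A 1
    r≢a₁ = levels A.dist≡ (A.d-start {1} (s≤s z≤n)) λ ()
    a₁≢b₂ : A 1 ≢ B 2
    a₁≢b₂ = levels (A.d-start {1} (s≤s z≤n)) (B.d-start {2} (s≤s (s≤s z≤n))) λ ()
    -- The walk through `x` gives at most 3. Distance 1 is the missing chord, and distance 2 would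
    -- put `B 2` on the level of its neighbour `r` around `A 1`.
    d-a₁b₂ : d (A 1) (B 2) ≡ 3
    d-a₁b₂ with d (A 1) (B 2) in eq | d-triangle (A 1) x (B 2)
    ... | 0 | _ = contradiction (d-zero eq) a₁≢b₂
    ... | 1 | _ with d-pred eq
    ...   | w , wb₂ , a₁w rewrite d-zero a₁w = contradiction (trans (sym a₁b₂) wb₂) λ ()
    d-a₁b₂ | 2 | _ = contradiction (trans eq (sym (same-side⇒d≡2 (≢-sym r≢a₁) (adj-sym a₁a₂) a₂r)))
      (graded (A 1) b₂r)
    d-a₁b₂ | 3 | _ = refl
    d-a₁b₂ | suc (suc (suc (suc k))) | le = contradiction
      (≤-trans le (+-mono-≤ (adj⇒d≤1 (adj-sym xa₁)) (≤-reflexive (B.d-start {2} (s≤s (s≤s z≤n)))))) λ { (s≤s (s≤s (s≤s ()))) }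
    via : Fin n → Fin n → ℕ → Fin n
    via s t 0 = A 1
    via s t 1 = s
    via s t 2 = t
    via s t (suc (suc (suc _))) = B 2
    geo : ∀ {s t} → adj G (A 1) s ≡ true → adj G s t ≡ true → adj G t (B 2) ≡ true → Geodesic (A 1) (B 2) 3 (via s t)
    geo as st tb = record { start = refl ; end = refl ; dist≡ = d-a₁b₂
      ; edge = λ { {0} _ → as ; {1} _ → st ; {2} _ → tb ; {suc (suc (suc _))} (s≤s (s≤s (s≤s ()))) } }
    -- The same hexagon read from a₁: the two paths are a₁ a₂ r b₂ and a₁ x b₁ b₂.
    φ : Theta (A 1) (B 2) 3
    φ = record
      { A = via (A 2) r ; B = via x (B 1)
      ; geoA = geo a₁a₂ a₂r (adj-sym b₂r) ; geoB = geo (adj-sym xa₁) xb₁ b₁b₂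
      ; disjoint = λ { {1} _ _ → ≢-sym (levels (d-refl x) (A.d-start {2} (s≤s (s≤s z≤n))) λ ())
                     ; {2} _ _ → levels A.dist≡ (B.d-start {1} (s≤s z≤n)) λ ()
                     ; {suc (suc (suc _))} _ (s≤s (s≤s (s≤s ()))) }
      ; 2≤p = s≤s (s≤s z≤n) }

  theta⇒goal : ∀ {x r p} → Theta x r p → Goal
  theta⇒goal {p = 0} θ = contradiction (Theta.2≤p θ) λ ()
  theta⇒goal {p = 1} θ = contradiction (Theta.2≤p θ) λ { (s≤s ()) }
  theta⇒goal {p = 2} θ = short-theta θ
  theta⇒goal {p = 3} θ = hexagon θ
  theta⇒goal {p = suc (suc (suc (suc _)))} θ = long-theta (s≤s (s≤s (s≤s (s≤s z≤n)))) θ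

  -- A vertex `x` with two parents `y` and `z` in the levels around `r`. The level k of the parents
  -- is the measure on which `fork⇒theta` recurses.
  record Fork (k : ℕ) : Set where
    field
      r x y z : Fin n
      y≢z     : y ≢ z
      xy      : adj G x y ≡ true
      xz      : adj G x z ≡ true
      d-x     : d r x ≡ suc k
      d-y     : d r y ≡ k
      d-z     : d r z ≡ k

  -- Follow parents from y and z towards r; if they meet before r, restart from the meeting point.
  fork⇒theta : ∀ {k} → Acc _<_ k → Fork k → ∃[ x ] ∃[ r ] ∃[ p ] Theta x r p
  fork⇒theta {k} (acc rec) F with anyUpTo? (λ i → ancestor r y i Fin.≟ ancestor r z i) k
    where open Fork F
  ... | yes (i , i<k , meet) = fork⇒theta (rec i<k) record
      { r = s ; x = x ; y = y ; z = z ; y≢z = y≢z ; xy = xy ; xz = xz ; d-x = d-sx ; d-y = d-sy ; d-z = d-sz }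
    where
    open Fork F
    s = ancestor r y i
    d-sy : d s y ≡ i
    d-sy = trans (d-sym s y) (d-from-ancestor r y i (subst (i ≤_) (sym d-y) (<⇒≤ i<k)))
    d-sz : d s z ≡ i
    d-sz = trans (d-sym s z) (trans (cong (d z) meet) (d-from-ancestor r z i (subst (i ≤_) (sym d-z) (<⇒≤ i<k))))
    d-sx : d s x ≡ suc i
    -- The lower bound holds because `s` is at level k - i: were `x` closer to it than suc i, it
    -- would be closer to `r` than suc k.
    d-sx = ≤-antisym (subst (λ j → d s x ≤ suc j) d-sy (d-step s (adj-sym xy))) (+-cancelˡ-≤ (k ∸ i) (suc i) _ (begin
      k ∸ i + suc i   ≡⟨ +-suc (k ∸ i) i ⟩
      suc (k ∸ i + i) ≡⟨ cong suc (m∸n+n≡m (<⇒≤ i<k)) ⟩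
      suc k           ≡⟨ d-x ⟨
      d r x           ≤⟨ d-triangle r s x ⟩
      d r s + d s x   ≡⟨ cong (_+ d s x) (trans (d-ancestor r y i) (cong (_∸ i) d-y)) ⟩
      k ∸ i + d s x   ∎))
      where open ≤-Reasoning
  ... | no apart = x , r , suc k , record
      { A = path y ; B = path z ; geoA = geo xy d-y ; geoB = geo xz d-z
      ; disjoint = λ { {suc i} _ (s≤s i<k) eq → apart (i , i<k , eq) }
      ; 2≤p = s≤s 0<k }
    where
    open Fork F
    path : Fin n → ℕ → Fin n
    path w zero    = x
    path w (suc i) = ancestor r w i
    geo : ∀ {w} → adj G x w ≡ true → d r w ≡ k → Geodesic x r (suc k) (path w)
    geo {w} xw d-w = record
      { start = refl
      ; end   = subst (λ i → ancestor r w i ≡ r) d-w (ancestor-root r w)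
      ; dist≡ = trans (d-sym x r) d-x
      ; edge  = λ { {zero} _ → xw ; {suc i} (s≤s i<k) → adj-sym (ancestor-adj r w i (subst (i <_) (sym d-w) i<k)) } }
    -- At level 0 both parents would be the root.
    0<k : 0 < k
    0<k = n≢0⇒n>0 λ { refl → y≢z (trans (sym (d-zero d-y)) (d-zero d-z)) }

-- Counting edges by level

𝟙*𝟙≤1 : ∀ a b → 𝟙 a * 𝟙 b ≤ 1
𝟙*𝟙≤1 true  b = ≤-trans (≤-reflexive (*-identityˡ (𝟙 b))) (𝟙≤1 b)
𝟙*𝟙≤1 false b = z≤n

𝟙*𝟙-positive : ∀ a b → 1 ≤ 𝟙 a * 𝟙 b → a ≡ true × b ≡ true
𝟙*𝟙-positive true true _ = refl , refl

≡ᵇ-refl : ∀ m → (m ≡ᵇ m) ≡ true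
≡ᵇ-refl zero    = refl
≡ᵇ-refl (suc m) = ≡ᵇ-refl m

≢⇒≡ᵇ-false : ∀ {m n} → m ≢ n → (m ≡ᵇ n) ≡ false
≢⇒≡ᵇ-false {zero}  {zero}  m≢n = contradiction refl m≢n
≢⇒≡ᵇ-false {zero}  {suc n} _   = refl
≢⇒≡ᵇ-false {suc m} {zero}  _   = refl
≢⇒≡ᵇ-false {suc m} {suc n} m≢n = ≢⇒≡ᵇ-false (m≢n ∘ cong suc)

𝟙-compare : ∀ m n → 𝟙 (m <ᵇ n) + 𝟙 (n <ᵇ m) + 𝟙 (m ≡ᵇ n) ≡ 1
𝟙-compare m n with m ≟ n
... | yes refl rewrite <ᵇ-false (≤-refl {m}) | ≡ᵇ-refl m = refl
... | no m≢n rewrite ≢⇒≡ᵇ-false m≢n = trans (+-identityʳ _) (𝟙-trichotomy m≢n)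

∑∑-adj : ∀ {n} (G : Graph n) → ∑ (allFin n) (λ u → ∑ (allFin n) (λ v → 𝟙 (adj G u v))) ≡ 2 * edgeCount G
∑∑-adj G = ∑∑≡2Σpairs (λ u v → 𝟙 (adj G u v)) (λ u v → cong 𝟙 (Graph.sym G u v)) (λ u → cong 𝟙 (irrefl G u))

module EdgeCount {n : ℕ} (G : Graph n) (M : IsMetric G (dist G)) where
  open Metric M
  open Separation G M

  lower : Fin n → Fin n → Fin n → ℕ
  lower r v a = 𝟙 (adj G a v) * 𝟙 (d r a <ᵇ d r v)

  level : Fin n → Fin n → Fin n → ℕ
  level r v a = 𝟙 (adj G a v) * 𝟙 (d r a ≡ᵇ d r v)

  -- The number of parents of `v` in the levels around `r`.
  down : Fin n → Fin n → ℕ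
  down r v = ∑ V (lower r v)

  -- Seen from `r`, an ordered adjacent pair goes up, goes down or stays level; reversal matches the
  -- first two kinds.
  edges-by-level : ∀ r → 2 * edgeCount G ≡ 2 * ∑ V (down r) + ∑ V (λ v → ∑ V (level r v))
  edges-by-level r = begin
    2 * edgeCount G
      ≡⟨ ∑∑-adj G ⟨
    ∑ V (λ u → ∑ V (λ v → 𝟙 (adj G u v)))
      ≡⟨ ∑-cong V (λ u → ∑-cong V (λ v → split u v)) ⟩
    ∑ V (λ u → ∑ V (λ v → lower r u v + lower r v u + level r u v))
      ≡⟨ ∑-cong V (λ u → trans (∑-+ V _ (level r u)) (cong (_+ ∑ V (level r u)) (∑-+ V (lower r u) (λ v → lower r v u)))) ⟩
    ∑ V (λ u → ∑ V (lower r u) + ∑ V (λ v → lower r v u) + ∑ V (level r u))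
      ≡⟨ trans (∑-+ V _ (λ u → ∑ V (level r u))) (cong (_+ L) (∑-+ V (down r) (λ u → ∑ V (λ v → lower r v u)))) ⟩
    D + ∑ V (λ u → ∑ V (λ v → lower r v u)) + L
      ≡⟨ cong (λ k → D + k + L) (∑-swap V V (λ u v → lower r v u)) ⟩
    D + D + L
      ≡⟨ cong (λ k → D + k + L) (+-identityʳ D) ⟨
    2 * D + L ∎
    where
    open ≡-Reasoning
    D = ∑ V (down r)
    L = ∑ V (λ v → ∑ V (level r v))
    split : ∀ u v → 𝟙 (adj G u v) ≡ lower r u v + lower r v u + level r u v
    split u v rewrite Graph.sym G v u with adj G u v
    ... | false = refl
    ... | true  = sym (trans
      (cong₂ _+_ (cong₂ _+_ (+-identityʳ (𝟙 (d r v <ᵇ d r u))) (+-identityʳ (𝟙 (d r u <ᵇ d r v)))) (+-identityʳ _))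
      (𝟙-compare (d r v) (d r u)))

  -- Completing down at the root makes it the constant 1 on a tree.
  down⁺ : Fin n → Fin n → ℕ
  down⁺ r v = down r v + 𝟙 ⌊ v Fin.≟ r ⌋ * 1

  ∑-down⁺ : ∀ r → ∑ V (down⁺ r) ≡ ∑ V (down r) + 1
  ∑-down⁺ r = trans (∑-+ V (down r) _) (cong (∑ V (down r) +_) (∑-δ r (λ _ → 1)))

  down-root : ∀ r → down r r ≡ 0
  down-root r = trans (∑-cong V (λ a → trans (cong (𝟙 (adj G a r) *_) (cong 𝟙 (<ᵇ-false (subst (_≤ d r a) (sym (d-refl r)) z≤n)))) (*-zeroʳ (𝟙 (adj G a r))))) (∑-zero V)

  lower⇒suc : ∀ {r v a} → adj G a v ≡ true → d r a < d r v → d r v ≡ suc (d r a)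
  lower⇒suc {r} a lt = ≤-antisym (d-step r a) lt

  -- Without horizontal edges every edge is one parent relation. If no vertex had two parents, then,
  -- the root having none, there would be fewer than n edges.
  fork : (graded : Graded G d) → Fin n → n ≤ edgeCount G → ∃[ k ] LowerBound.Fork G M graded k
  fork graded r n≤m with Fin.any? (λ v → 2 ≤? down r v)
  ... | yes (v , 2≤) with ∑-two V (lower r v) (allFin⁺ n) (λ a → 𝟙*𝟙≤1 (adj G a v) (d r a <ᵇ d r v)) 2≤
  ...   | y , z , y≢z , fy , fz with 𝟙*𝟙-positive _ _ fy | 𝟙*𝟙-positive _ _ fz
  ...     | yv , y< | zv , z< = d r y , record
    { r = r ; x = v ; y = y ; z = z ; y≢z = y≢z ; xy = adj-sym yv ; xz = adj-sym zv
    ; d-x = d-v ; d-y = refl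
    ; d-z = suc-injective (trans (sym (lower⇒suc zv (<ᵇ-true⁻¹ z<))) d-v) }
    where d-v = lower⇒suc yv (<ᵇ-true⁻¹ y<)
  fork graded r n≤m | no none = contradiction n≤m (<⇒≱ (begin-strict
    edgeCount G             ≡⟨ *-cancelˡ-≡ (edgeCount G) (∑ V (down r)) 2 no-level ⟩
    ∑ V (down r)            <⟨ m<m+n _ (s≤s z≤n) ⟩
    ∑ V (down r) + 1        ≡⟨ ∑-down⁺ r ⟨
    ∑ V (down⁺ r)           ≤⟨ ∑-upper V 1 at-most-one ⟩
    length V * 1            ≡⟨ trans (*-identityʳ _) (length-allFin n) ⟩
    n                       ∎))
    where
    open ≤-Reasoning
    level≡0 : ∀ v a → level r v a ≡ 0
    level≡0 v a with adj G a v in av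
    ... | false = refl
    ... | true rewrite ≢⇒≡ᵇ-false (graded r av) = refl
    no-level : 2 * edgeCount G ≡ 2 * ∑ V (down r)
    no-level = trans (edges-by-level r) (trans
      (cong (2 * ∑ V (down r) +_) (trans (∑-cong V (λ v → trans (∑-cong V (level≡0 v)) (∑-zero V))) (∑-zero V)))
      (+-identityʳ _))
    at-most-one : ∀ v → down⁺ r v ≤ 1
    at-most-one v with v Fin.≟ r
    ... | yes refl = ≤-reflexive (cong (_+ 1) (down-root r))
    ... | no _     = subst (_≤ 1) (sym (+-identityʳ _)) (s≤s⁻¹ (≰⇒> λ 2≤ → none (v , 2≤)))

bipartite-lower-bound : (n : ℕ) (G : Graph n) → 4 ≤ n → Connected G → Bipartite G → n ≤ edgeCount G →
  W G + (4 * n ∸ 8) ≤ Sz G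
bipartite-lower-bound n G 4≤n conn bip n≤m =
  -- Any vertex can serve as the root; `4 ≤ n`, read as `3 < n`, supplies one.
  let _ , F = fork graded (fromℕ< 4≤n) n≤m
      _ , _ , _ , θ = fork⇒theta (<-wellFounded _) F
  in theta⇒goal θ
  where
  M = dist-isMetric G conn
  graded = bipartite⇒graded M bip
  open EdgeCount G M using (fork)
  open LowerBound G M graded using (fork⇒theta; theta⇒goal)

-- Distances and separating edges in a tree

module TreeMetric {n : ℕ} (T : Graph n) (M : IsMetric T (dist T)) (edges : suc (edgeCount T) ≡ n) where
  open Metric M
  open Separation T M
  open EdgeCount T M

  down⁺≥1 : ∀ r v → 1 ≤ down⁺ r v
  down⁺≥1 r v with v Fin.≟ r
  ... | yes _  = m≤n+m 1 _
  ... | no v≢r = ≤-trans (≤-trans (≤-reflexive (sym lower≡1)) (term≤∑ (lower r v) (∈-allFin (parent r v)))) (m≤m+n _ _)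
    where
    0<d : 0 < d r v
    0<d = n≢0⇒n>0 λ eq → v≢r (sym (d-zero eq))
    below : d r (parent r v) < d r v
    below = subst₂ _≤_ (cong suc (sym (d-parent r v))) refl (≤-reflexive (m+[n∸m]≡n 0<d))
    lower≡1 : lower r v (parent r v) ≡ 1
    lower≡1 = cong₂ (λ a b → 𝟙 a * 𝟙 b) (parent-adj r v 0<d) (<ᵇ-true below)

  -- Every vertex other than `r` has a parent, so there are at least n - 1 parent relations.
  edges≤∑down : ∀ r → edgeCount T ≤ ∑ V (down r)
  edges≤∑down r = s≤s⁻¹ (begin
    suc (edgeCount T)      ≡⟨ edges ⟩
    n                      ≡⟨ trans (*-identityʳ _) (length-allFin n) ⟨
    length V * 1           ≤⟨ ∑-lower V 1 (λ {v} _ → down⁺≥1 r v) ⟩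
    ∑ V (down⁺ r)          ≡⟨ ∑-down⁺ r ⟩
    ∑ V (down r) + 1       ≡⟨ +-comm _ 1 ⟩
    suc (∑ V (down r))     ∎)
    where open ≤-Reasoning

  -- Parent relations use up all the edges, so `edges-by-level` has nothing left for horizontal
  -- ones.
  graded : Graded T d
  graded r {u} {v} a eq = contradiction (begin
    1                               ≡⟨ cong₂ (λ a b → 𝟙 a * 𝟙 b) a (trans (cong (_≡ᵇ d r v) eq) (≡ᵇ-refl (d r v))) ⟨
    level r v u                     ≤⟨ term≤∑ (level r v) (∈-allFin u) ⟩
    ∑ V (level r v)                 ≤⟨ term≤∑ (λ v → ∑ V (level r v)) (∈-allFin v) ⟩
    ∑ V (λ v → ∑ V (level r v))     ≤⟨ +-cancelˡ-≤ (2 * ∑ V (down r)) _ 0 none ⟩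
    0                               ∎) λ ()
    where
    open ≤-Reasoning
    none : 2 * ∑ V (down r) + ∑ V (λ v → ∑ V (level r v)) ≤ 2 * ∑ V (down r) + 0
    none = subst₂ _≤_ (edges-by-level r) (sym (+-identityʳ _)) (*-monoʳ-≤ 2 (edges≤∑down r))

  -- The converse count: at most n relations, the artificial one at `r` included, are shared by n
  -- vertices that each have at least one.
  down≤1 : ∀ r v → down r v ≤ 1
  down≤1 r v = ≤-trans (m≤m+n _ _) (∑-tight V (down⁺ r) (down⁺≥1 r) (begin
    ∑ V (down⁺ r)          ≡⟨ ∑-down⁺ r ⟩
    ∑ V (down r) + 1       ≤⟨ +-monoˡ-≤ 1 ∑down≤edges ⟩
    edgeCount T + 1        ≡⟨ trans (+-comm _ 1) edges ⟩
    n                      ≡⟨ length-allFin n ⟨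
    length V               ∎) (∈-allFin v))
    where
    open ≤-Reasoning
    ∑down≤edges : ∑ V (down r) ≤ edgeCount T
    ∑down≤edges = *-cancelˡ-≤ 2 (subst (2 * ∑ V (down r) ≤_) (sym (edges-by-level r)) (m≤m+n _ _))

  lower-unique : ∀ {r v a b} → adj T a v ≡ true → adj T b v ≡ true → d r a < d r v → d r b < d r v → a ≡ b
  lower-unique {r} {v} {a} {b} av bv a< b< with a Fin.≟ b
  ... | yes a≡b = a≡b
  ... | no a≢b  = contradiction (≤-trans (≤-trans two (∑-unique-⊆ (a ∷ b ∷ []) (lower r v) ((a≢b ∷ []) ∷ [] ∷ []) (λ {x} _ → ∈-allFin x))) (down≤1 r v)) λ { (s≤s ()) }
    where
    lower≡1 : ∀ {c} → adj T c v ≡ true → d r c < d r v → lower r v c ≡ 1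
    lower≡1 cv c< = cong₂ (λ a b → 𝟙 a * 𝟙 b) cv (<ᵇ-true c<)
    two : 2 ≤ lower r v a + (lower r v b + 0)
    two = ≤-reflexive (sym (cong₂ (λ k l → k + (l + 0)) (lower≡1 av a<) (lower≡1 bv b<)))

  -- An edge ab that separates the ends of the edge uw is uw itself: otherwise b has two neighbours
  -- closer to u, namely a and the parent of b towards w.
  separating-edge-unique : ∀ {u w a b} → adj T u w ≡ true → adj T a b ≡ true →
    d u a < d u b → d w b < d w a → a ≡ u × b ≡ w
  separating-edge-unique {u} {w} {a} {b} uw ab ua<ub wb<wa = go (d w b) refl
    where
    -- The chain 1 + d w b ≤ d w a ≤ 1 + d u a ≤ d u b ≤ 1 + d w b closes up, so each of its steps
    -- is an equality.
    ub≡ : d u b ≡ suc (d w b)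
    ub≡ = ≤-antisym (≤-trans (d-triangle u w b) (+-monoˡ-≤ _ (adj⇒d≤1 uw))) (begin
      suc (d w b)       ≤⟨ wb<wa ⟩
      d w a             ≤⟨ d-triangle w u a ⟩
      d w u + d u a     ≤⟨ +-monoˡ-≤ _ (adj⇒d≤1 (adj-sym uw)) ⟩
      suc (d u a)       ≤⟨ ua<ub ⟩
      d u b             ∎)
      where open ≤-Reasoning
    ua≡ : d u a ≡ d w b
    ua≡ = suc-injective (trans (sym (≤-antisym (d-step u ab) ua<ub)) ub≡)
    go : ∀ k → d w b ≡ k → a ≡ u × b ≡ w
    go zero    eq = sym (d-zero (trans ua≡ eq)) , sym (d-zero eq)
    go (suc k) eq with d-pred eq
    ... | c , cb , wc = contradiction (subst (λ x → d w b < d w x) (lower-unique ab cb ua<ub uc<ub) wb<wa)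
      (≤⇒≯ (subst₂ _≤_ (sym wc) (sym eq) (n≤1+n k)))
      where
      uc<ub : d u c < d u b
      uc<ub = subst (d u c <_) (sym (trans ub≡ (cong suc eq))) (s≤s
        (subst (d u c ≤_) (cong suc wc) (≤-trans (d-triangle u w c) (+-monoˡ-≤ _ (adj⇒d≤1 uw)))))

  μ-adjacent : ∀ {u w} → adj T u w ≡ true → μ u w ≤ 1
  μ-adjacent {u} {w} uw = begin
    ∑ V (λ a → ∑ V (sep u w a))
      ≤⟨ ∑-mono V (λ a → ∑-mono V (bound a)) ⟩
    ∑ V (λ a → ∑ V (λ b → 𝟙 ⌊ a Fin.≟ u ⌋ * (𝟙 ⌊ b Fin.≟ w ⌋ * 1)))
      ≡⟨ ∑-cong V (λ a → trans (∑-*ˡ V (𝟙 ⌊ a Fin.≟ u ⌋) _) (cong (𝟙 ⌊ a Fin.≟ u ⌋ *_) (∑-δ w (λ _ → 1)))) ⟩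
    ∑ V (λ a → 𝟙 ⌊ a Fin.≟ u ⌋ * 1)
      ≡⟨ ∑-δ u (λ _ → 1) ⟩
    1 ∎
    where
    open ≤-Reasoning
    self : ∀ x → 𝟙 ⌊ x Fin.≟ x ⌋ ≡ 1
    self x with x Fin.≟ x
    ... | yes _  = refl
    ... | no x≢x = contradiction refl x≢x
    bound : ∀ a b → sep u w a b ≤ 𝟙 ⌊ a Fin.≟ u ⌋ * (𝟙 ⌊ b Fin.≟ w ⌋ * 1)
    bound a b with adj T a b in ab | d a u <ᵇ d b u in ua | d b w <ᵇ d a w in wb
    ... | false | _     | _     = z≤n
    ... | true  | false | _     = z≤n
    ... | true  | true  | false = z≤n
    ... | true  | true  | true with separating-edge-unique uw ab
            (subst₂ _<_ (d-sym a u) (d-sym b u) (<ᵇ-true⁻¹ ua)) (subst₂ _<_ (d-sym b w) (d-sym a w) (<ᵇ-true⁻¹ wb))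
    ...   | refl , refl = ≤-reflexive (sym (cong₂ (λ k l → k * (l * 1)) (self a) (self b)))

  -- By gradedness `x` lies on one side of every edge that separates `v` from `y`, so that edge
  -- separates `v` from `x` or `x` from `y`.
  μ-triangle : ∀ v x y → μ v y ≤ μ v x + μ x y
  μ-triangle v x y = subst (μ v y ≤_)
    (trans (∑-cong V (λ a → ∑-+ V (sep v x a) (sep x y a))) (∑-+ V _ _))
    (∑-mono V (λ a → ∑-mono V (pointwise a)))
    where
    pointwise : ∀ a b → sep v y a b ≤ sep v x a b + sep x y a b
    pointwise a b with adj T a b in ab
    ... | false = z≤n
    ... | true with <-cmp (d x a) (d x b)
    ...   | tri≈ _ eq _ = contradiction eq (graded x ab)
    ...   | tri< lt _ _ = begin
      closer a b v * closer b a y + 0 ≡⟨ +-identityʳ _ ⟩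
      closer a b v * closer b a y     ≤⟨ *-monoˡ-≤ (closer b a y) (𝟙≤1 (d a v <ᵇ d b v)) ⟩
      1 * closer b a y                ≡⟨ cong (_* closer b a y) (closer-true lt) ⟨
      closer a b x * closer b a y     ≡⟨ +-identityʳ _ ⟨
      closer a b x * closer b a y + 0 ≤⟨ m≤n+m (closer a b x * closer b a y + 0) (closer a b v * closer b a x + 0) ⟩
      closer a b v * closer b a x + 0 + (closer a b x * closer b a y + 0) ∎
      where open ≤-Reasoning
    ...   | tri> _ _ gt = begin
      closer a b v * closer b a y + 0 ≡⟨ +-identityʳ _ ⟩
      closer a b v * closer b a y     ≤⟨ *-monoʳ-≤ (closer a b v) (𝟙≤1 (d b y <ᵇ d a y)) ⟩
      closer a b v * 1                ≡⟨ cong (closer a b v *_) (closer-true gt) ⟨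
      closer a b v * closer b a x     ≡⟨ +-identityʳ _ ⟨
      closer a b v * closer b a x + 0 ≤⟨ m≤m+n _ _ ⟩
      closer a b v * closer b a x + 0 + (closer a b x * closer b a y + 0) ∎
      where open ≤-Reasoning

  closer-exclusive : ∀ a b v → closer a b v * closer b a v ≡ 0
  closer-exclusive a b v with <-cmp (d v a) (d v b)
  ... | tri< lt _ _ = trans (cong (closer a b v *_) (closer-false (<⇒≤ lt))) (*-zeroʳ (closer a b v))
  ... | tri≈ _ eq _ = cong (_* closer b a v) (closer-false (≤-reflexive (sym eq)))
  ... | tri> _ _ gt = cong (_* closer b a v) (closer-false (<⇒≤ gt))

  -- Along a geodesic each step adds at most the one edge that separates its own ends.
  μ≤d : ∀ v y → μ v y ≤ d v y
  μ≤d v y = go (d v y) refl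
    where
    go : ∀ k {y} → d v y ≡ k → μ v y ≤ k
    go zero eq with d-zero eq
    ... | refl = ≤-reflexive (trans (∑-cong V (λ a → trans (∑-cong V (λ b →
      trans (cong (𝟙 (adj T a b) *_) (closer-exclusive a b v)) (*-zeroʳ (𝟙 (adj T a b))))) (∑-zero V))) (∑-zero V))
    go (suc k) {y} eq with d-pred eq
    ... | w , wy , vw = subst (μ v y ≤_) (+-comm k 1) (≤-trans (μ-triangle v w y) (+-mono-≤ (go k vw) (μ-adjacent wy)))

-- A 4-cycle glued to a tree

-- `nClose` for an arbitrary metric, so that it can be evaluated on an explicit one.
closerCount : ∀ {n} → (Fin n → Fin n → ℕ) → Fin n → Fin n → ℕ
closerCount {n} d a b = ∑ (allFin n) (λ w → 𝟙 (d a w <ᵇ d b w))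

module _ {n : ℕ} {G : Graph n} {d : Fin n → Fin n → ℕ} (M : IsMetric G d) where
  open MetricIsDist G M
  open Separation G (dist-isMetric G connected) using (∑∑-dist; ∑∑-nClose)

  ∑∑-metric : ∑ (allFin n) (λ u → ∑ (allFin n) (d u)) ≡ 2 * W G
  ∑∑-metric = trans (∑-cong (allFin n) (λ u → ∑-cong (allFin n) (λ v → sym (dist≡d u v)))) ∑∑-dist

  ∑∑-closerCount : ∑ (allFin n) (λ a → ∑ (allFin n) (λ b → 𝟙 (adj G a b) * (closerCount d a b * closerCount d b a))) ≡ 2 * Sz G
  ∑∑-closerCount = trans (∑-cong (allFin n) (λ a → ∑-cong (allFin n) (λ b →
    cong (𝟙 (adj G a b) *_) (cong₂ _*_ (same a b) (same b a))))) ∑∑-nClose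
    where
    same : ∀ a b → closerCount d a b ≡ nClose G a b
    same a b = ∑-cong (allFin n) (λ w → cong₂ (λ k l → 𝟙 (k <ᵇ l)) (sym (dist≡d a w)) (sym (dist≡d b w)))

-- What the gluing needs from the tree. The double sum in `far-side≤` counts the pairs of a vertex y
-- and an edge separating `s` from y; it arises because all three new vertices join the side of `s`.
record TreeBounds {n} (T : Graph n) (d : Fin n → Fin n → ℕ) : Set where
  field
    metric   : IsMetric T d
    graded   : Graded T d
    sz≤      : ∑ (allFin n) (λ a → ∑ (allFin n) (λ b → 𝟙 (adj T a b) * (closerCount d a b * closerCount d b a)))
             ≤ ∑ (allFin n) (λ u → ∑ (allFin n) (d u))
    far-side≤ : ∀ s → ∑ (allFin n) (λ a → ∑ (allFin n) (λ b → 𝟙 (adj T a b) * (𝟙 (d a s <ᵇ d b s) * closerCount d b a)))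
             ≤ ∑ (allFin n) (d s)

tree-bounds : ∀ {n} (T : Graph n) → Connected T → suc (edgeCount T) ≡ n → ∃[ d ] TreeBounds T d
tree-bounds {n} T conn edges = dist T , record
  { metric = M
  ; graded = graded
  ; sz≤ = subst (_≤ ∑ V (λ u → ∑ V (d u))) (trans ∑∑-μ (sym ∑∑-nClose)) (∑-mono V (λ u → ∑-mono V (μ≤d u)))
  ; far-side≤ = λ s → subst (_≤ ∑ V (d s)) (trans (sym (rotate (λ a b y → sep s y a b))) (∑-cong V (λ a → ∑-cong V (λ b → collect s a b))))
      (∑-mono V (μ≤d s))
  }
  where
  M = dist-isMetric T conn
  open Separation T M
  open TreeMetric T M edges
  collect : ∀ s a b → ∑ V (λ y → sep s y a b) ≡ 𝟙 (adj T a b) * (closer a b s * nClose T b a)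
  collect s a b = trans (∑-*ˡ V (𝟙 (adj T a b)) _) (cong (𝟙 (adj T a b) *_) (∑-*ˡ V (closer a b s) (closer b a)))

attached : Bool → Fin 3 → Bool
attached b 0F = b
attached b 1F = false
attached b 2F = b

path₃ : Fin 3 → Fin 3 → Bool
path₃ 0F 1F = true
path₃ 1F 0F = true
path₃ 1F 2F = true
path₃ 2F 1F = true
path₃ _  _  = false

-- The adjacency of `C4⊙T` on `Fin k ⊎ Fin 3`, which allows case distinction on the two kinds of
-- vertices; `gAdj-glued` makes the identification.
gluedAdj : ∀ {k} → Graph k → Fin k → Fin k ⊎ Fin 3 → Fin k ⊎ Fin 3 → Bool
gluedAdj T s (inj₁ x) (inj₁ y) = adj T x y
gluedAdj T s (inj₁ x) (inj₂ z) = attached ⌊ x Fin.≟ s ⌋ z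
gluedAdj T s (inj₂ z) (inj₁ x) = attached ⌊ x Fin.≟ s ⌋ z
gluedAdj T s (inj₂ z) (inj₂ w) = path₃ z w

-- Distance in the 4-cycle from the shared vertex.
height : Fin 3 → ℕ
height 0F = 1
height 1F = 2
height 2F = 1

d₃ : Fin 3 → Fin 3 → ℕ
d₃ 0F 0F = 0
d₃ 0F 1F = 1
d₃ 0F 2F = 2
d₃ 1F 0F = 1
d₃ 1F 1F = 0
d₃ 1F 2F = 1
d₃ 2F 0F = 2
d₃ 2F 1F = 1
d₃ 2F 2F = 0

d₃-refl : ∀ z → d₃ z z ≡ 0
d₃-refl 0F = refl
d₃-refl 1F = refl
d₃-refl 2F = refl

d₃-zero : ∀ {z w} → d₃ z w ≡ 0 → z ≡ w
d₃-zero {0F} {0F} _ = refl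
d₃-zero {1F} {1F} _ = refl
d₃-zero {2F} {2F} _ = refl
d₃-zero {0F} {1F} ()
d₃-zero {0F} {2F} ()
d₃-zero {1F} {2F} ()

d₃-step : ∀ u w v → path₃ w v ≡ true → d₃ u v ≤ suc (d₃ u w)
d₃-step = from-yes (Fin.all? λ u → Fin.all? λ w → Fin.all? λ v → (path₃ w v ≟ᵇ true) →-dec (d₃ u v ≤? suc (d₃ u w)))

height-step : ∀ w v → path₃ w v ≡ true → height v ≤ suc (height w)
height-step = from-yes (Fin.all? λ w → Fin.all? λ v → (path₃ w v ≟ᵇ true) →-dec (height v ≤? suc (height w)))

attached-d₃ : ∀ c z → attached true z ≡ true → d₃ c z ≤ suc (height c)
attached-d₃ = from-yes (Fin.all? λ c → Fin.all? λ z → (attached true z ≟ᵇ true) →-dec (d₃ c z ≤? suc (height c)))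

attached-height : ∀ c z → attached true z ≡ true → height c ≤ suc (d₃ c z)
attached-height = from-yes (Fin.all? λ c → Fin.all? λ z → (attached true z ≟ᵇ true) →-dec (height c ≤? suc (d₃ c z)))

attached-height₁ : ∀ z → attached true z ≡ true → height z ≡ 1
attached-height₁ 0F _ = refl
attached-height₁ 2F _ = refl

attached⁻¹ : ∀ {k} {x s : Fin k} z → attached ⌊ x Fin.≟ s ⌋ z ≡ true → x ≡ s × attached true z ≡ true
attached⁻¹ {x = x} {s} 0F a with x Fin.≟ s
... | yes x≡s = x≡s , refl
attached⁻¹ {x = x} {s} 2F a with x Fin.≟ s
... | yes x≡s = x≡s , refl

≟-refl : ∀ {k} (s : Fin k) → ⌊ s Fin.≟ s ⌋ ≡ true
≟-refl s with s Fin.≟ s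
... | yes _  = refl
... | no s≢s = contradiction refl s≢s

splitAt-injective : ∀ m {n} {a b : Fin (m + n)} → splitAt m a ≡ splitAt m b → a ≡ b
splitAt-injective m {n} {a} {b} eq =
  trans (sym (Fin.join-splitAt m n a)) (trans (cong (join m n) eq) (Fin.join-splitAt m n b))

∑∑-splitAt : ∀ m {k} (f : Fin m ⊎ Fin k → Fin m ⊎ Fin k → ℕ) → (∀ p q → f p q ≡ f q p) →
  ∑ (allFin (m + k)) (λ a → ∑ (allFin (m + k)) (λ b → f (splitAt m a) (splitAt m b)))
  ≡ ∑ (allFin m) (λ x → ∑ (allFin m) (λ y → f (inj₁ x) (inj₁ y)))
    + 2 * ∑ (allFin k) (λ z → ∑ (allFin m) (λ x → f (inj₁ x) (inj₂ z)))
    + ∑ (allFin k) (λ z → ∑ (allFin k) (λ w → f (inj₂ z) (inj₂ w)))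
∑∑-splitAt m {k} f f-sym = begin
  ∑ (allFin (m + k)) (λ a → ∑ (allFin (m + k)) (λ b → f (splitAt m a) (splitAt m b)))
    ≡⟨ ∑-cong (allFin (m + k)) (λ a → ∑-splitAt m (f (splitAt m a))) ⟩
  ∑ (allFin (m + k)) (λ a → row (splitAt m a))
    ≡⟨ ∑-splitAt m row ⟩
  ∑ X (λ x → row (inj₁ x)) + ∑ Z (λ z → row (inj₂ z))
    ≡⟨ cong₂ _+_ (∑-+ X _ _) (∑-+ Z _ _) ⟩
  (XX + ∑ X (λ x → ∑ Z (λ z → f (inj₁ x) (inj₂ z)))) + (∑ Z (λ z → ∑ X (λ x → f (inj₂ z) (inj₁ x))) + ZZ)
    ≡⟨ cong₂ (λ a b → (XX + a) + (b + ZZ)) (∑-swap X Z _) (∑-cong Z (λ z → ∑-cong X (λ x → f-sym (inj₂ z) (inj₁ x)))) ⟩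
  (XX + ZX) + (ZX + ZZ)
    ≡⟨ regroup XX ZX ZZ ⟩
  XX + 2 * ZX + ZZ ∎
  where
  open ≡-Reasoning
  X = allFin m
  Z = allFin k
  row : Fin m ⊎ Fin k → ℕ
  row p = ∑ X (λ x → f p (inj₁ x)) + ∑ Z (λ z → f p (inj₂ z))
  XX = ∑ X (λ x → ∑ X (λ y → f (inj₁ x) (inj₁ y)))
  ZX = ∑ Z (λ z → ∑ X (λ x → f (inj₁ x) (inj₂ z)))
  ZZ = ∑ Z (λ z → ∑ Z (λ w → f (inj₂ z) (inj₂ w)))
  regroup : ∀ a b c → (a + b) + (b + c) ≡ a + 2 * b + c
  regroup = solve-∀

module Glue {k : ℕ} (T : Graph k) (s : Fin k) (G : Graph (k + 3))
  (adj-G : ∀ a b → adj G a b ≡ gluedAdj T s (splitAt k a) (splitAt k b))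
  (d : Fin k → Fin k → ℕ) (bounds : TreeBounds T d) (edges : suc (edgeCount T) ≡ k) where

  open TreeBounds bounds
  open Metric metric

  X : List (Fin k)
  X = allFin k

  I : Set
  I = Fin k ⊎ Fin 3

  E : I → I → Bool
  E = gluedAdj T s

  E-sym : ∀ p q → E p q ≡ E q p
  E-sym (inj₁ x) (inj₁ y) = Graph.sym T x y
  E-sym (inj₁ x) (inj₂ z) = refl
  E-sym (inj₂ z) (inj₁ x) = refl
  E-sym (inj₂ z) (inj₂ w) = from-yes (Fin.all? λ z → Fin.all? λ w → path₃ z w ≟ᵇ path₃ w z) z w

  -- All walks between the tree and the new vertices pass through `s`, so distances add up there;
  -- inside either part a detour through the other is never shorter.
  D : I → I → ℕ
  D (inj₁ x) (inj₁ y) = d x y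
  D (inj₁ x) (inj₂ z) = height z + d x s
  D (inj₂ z) (inj₁ x) = height z + d s x
  D (inj₂ z) (inj₂ w) = d₃ z w

  D-sym : ∀ p q → D p q ≡ D q p
  D-sym (inj₁ x) (inj₁ y) = d-sym x y
  D-sym (inj₁ x) (inj₂ z) = cong (height z +_) (d-sym x s)
  D-sym (inj₂ z) (inj₁ x) = cong (height z +_) (d-sym s x)
  D-sym (inj₂ z) (inj₂ w) = from-yes (Fin.all? λ z → Fin.all? λ w → d₃ z w ≟ d₃ w z) z w

  height≢0 : ∀ z {m} → height z + m ≢ 0
  height≢0 0F ()
  height≢0 1F ()
  height≢0 2F ()

  D-refl : ∀ p → D p p ≡ 0
  D-refl (inj₁ x) = d-refl x
  D-refl (inj₂ z) = d₃-refl z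

  D-zero : ∀ p q → D p q ≡ 0 → p ≡ q
  D-zero (inj₁ x) (inj₁ y) eq = cong inj₁ (d-zero eq)
  D-zero (inj₁ x) (inj₂ z) eq = contradiction eq (height≢0 z)
  D-zero (inj₂ z) (inj₁ x) eq = contradiction eq (height≢0 z)
  D-zero (inj₂ z) (inj₂ w) eq = cong inj₂ (d₃-zero eq)

  D-step : ∀ p q r → E q r ≡ true → D p r ≤ suc (D p q)
  D-step (inj₁ u) (inj₁ w) (inj₁ v) a = d-step u a
  D-step (inj₁ u) (inj₁ w) (inj₂ z) a with attached⁻¹ z a
  ... | refl , z-att rewrite attached-height₁ z z-att = ≤-refl
  D-step (inj₁ u) (inj₂ z) (inj₁ v) a with attached⁻¹ z a
  ... | refl , _ = m≤n⇒m≤1+n (m≤n+m (d u v) (height z))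
  D-step (inj₁ u) (inj₂ z) (inj₂ w) a = +-monoˡ-≤ (d u s) (height-step z w a)
  D-step (inj₂ c) (inj₁ w) (inj₁ v) a =
    ≤-trans (+-monoʳ-≤ (height c) (d-step s a)) (≤-reflexive (+-suc (height c) (d s w)))
  D-step (inj₂ c) (inj₁ w) (inj₂ z) a with attached⁻¹ z a
  ... | refl , z-att = ≤-trans (attached-d₃ c z z-att) (s≤s (m≤m+n (height c) _))
  D-step (inj₂ c) (inj₂ z) (inj₁ v) a with attached⁻¹ z a
  ... | refl , z-att = ≤-trans (≤-reflexive (trans (cong (height c +_) (d-refl s)) (+-identityʳ _))) (attached-height c z z-att)
  D-step (inj₂ c) (inj₂ z) (inj₂ w) a = d₃-step c z w a

  D-pred : ∀ p q {m} → D p q ≡ suc m → ∃[ r ] (E r q ≡ true × D p r ≡ m)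
  D-pred (inj₁ u) (inj₁ v) eq = let w , a , eq′ = d-pred eq in inj₁ w , a , eq′
  D-pred (inj₁ u) (inj₂ 0F) eq = inj₁ s , ≟-refl s , suc-injective eq
  D-pred (inj₁ u) (inj₂ 1F) eq = inj₂ 0F , refl , suc-injective eq
  D-pred (inj₁ u) (inj₂ 2F) eq = inj₁ s , ≟-refl s , suc-injective eq
  D-pred (inj₂ c) (inj₁ v) {m} eq with d s v in sv
  ... | suc l = let w , a , eq′ = d-pred sv in
    inj₁ w , a , suc-injective (trans (cong (λ l → suc (height c + l)) eq′) (trans (sym (+-suc (height c) l)) eq))
  ... | zero with d-zero sv
  ...   | refl = last c eq
    where
    -- Here the target is `s` itself, so the previous vertex lies on the cycle. From the vertex
    -- opposite to `s` both neighbours of `s` would do; 0F is taken.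
    last : ∀ c → height c + 0 ≡ suc m → ∃[ r ] (E r (inj₁ s) ≡ true × D (inj₂ c) r ≡ m)
    last 0F eq = inj₂ 0F , ≟-refl s , suc-injective eq
    last 1F eq = inj₂ 0F , ≟-refl s , suc-injective eq
    last 2F eq = inj₂ 2F , ≟-refl s , suc-injective eq
  D-pred (inj₂ 0F) (inj₂ 1F) eq = inj₂ 0F , refl , suc-injective eq
  D-pred (inj₂ 0F) (inj₂ 2F) eq = inj₂ 1F , refl , suc-injective eq
  D-pred (inj₂ 1F) (inj₂ 0F) eq = inj₂ 1F , refl , suc-injective eq
  D-pred (inj₂ 1F) (inj₂ 2F) eq = inj₂ 1F , refl , suc-injective eq
  D-pred (inj₂ 2F) (inj₂ 0F) eq = inj₂ 1F , refl , suc-injective eq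
  D-pred (inj₂ 2F) (inj₂ 1F) eq = inj₂ 2F , refl , suc-injective eq
  D-pred (inj₂ 2F) (inj₂ 2F) ()

  dG : Fin (k + 3) → Fin (k + 3) → ℕ
  dG a b = D (splitAt k a) (splitAt k b)

  dG-isMetric : IsMetric G dG
  dG-isMetric = record
    { d-refl = λ a → D-refl (splitAt k a)
    ; d-zero = λ {a} {b} eq → splitAt-injective k (D-zero (splitAt k a) (splitAt k b) eq)
    ; d-step = λ a {b} {c} bc → D-step (splitAt k a) (splitAt k b) (splitAt k c) (trans (sym (adj-G b c)) bc)
    ; d-pred = λ {a} {b} eq → let r , rb , eq′ = D-pred (splitAt k a) (splitAt k b) eq in
        join k 3 r
        , trans (adj-G (join k 3 r) b) (trans (cong (λ p → E p (splitAt k b)) (Fin.splitAt-join k 3 r)) rb)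
        , trans (cong (D (splitAt k a)) (Fin.splitAt-join k 3 r)) eq′
    }

  connected : Connected G
  connected = MetricIsDist.connected G dG-isMetric

  colour : I → Bool
  colour (inj₁ x)  = isOdd (d s x)
  colour (inj₂ 0F) = true
  colour (inj₂ 1F) = false
  colour (inj₂ 2F) = true

  colour-proper : ∀ p q → E p q ≡ true → colour p ≢ colour q
  colour-proper (inj₁ x) (inj₁ y) a = differ (d-step s (adj-sym a)) (d-step s a) (graded s a)
    where
    not-self : ∀ b → b ≢ not b
    not-self true  ()
    not-self false ()
    differ : ∀ {m n} → m ≤ suc n → n ≤ suc m → m ≢ n → isOdd m ≢ isOdd n
    differ {m} {n} m≤ n≤ m≢n with <-cmp m n
    ... | tri< m<n _ _ rewrite ≤-antisym n≤ m<n = not-self (isOdd m)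
    ... | tri≈ _ m≡n _ = contradiction m≡n m≢n
    ... | tri> _ _ n<m rewrite ≤-antisym m≤ n<m = ≢-sym (not-self (isOdd n))
  colour-proper (inj₁ x) (inj₂ 0F) a with attached⁻¹ {x = x} {s} 0F a
  ... | refl , _ rewrite d-refl s = λ ()
  colour-proper (inj₁ x) (inj₂ 2F) a with attached⁻¹ {x = x} {s} 2F a
  ... | refl , _ rewrite d-refl s = λ ()
  colour-proper (inj₂ 0F) (inj₁ x) a with attached⁻¹ {x = x} {s} 0F a
  ... | refl , _ rewrite d-refl s = λ ()
  colour-proper (inj₂ 2F) (inj₁ x) a with attached⁻¹ {x = x} {s} 2F a
  ... | refl , _ rewrite d-refl s = λ ()
  colour-proper (inj₂ 0F) (inj₂ 1F) a = λ ()
  colour-proper (inj₂ 1F) (inj₂ 0F) a = λ ()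
  colour-proper (inj₂ 1F) (inj₂ 2F) a = λ ()
  colour-proper (inj₂ 2F) (inj₂ 1F) a = λ ()

  bipartite : Bipartite G
  bipartite = colour ∘ splitAt k , λ a b ab → colour-proper (splitAt k a) (splitAt k b) (trans (sym (adj-G a b)) ab)

  edgeCount-G : edgeCount G ≡ k + 3
  edgeCount-G = *-cancelˡ-≡ (edgeCount G) (k + 3) 2 (begin
    2 * edgeCount G
      ≡⟨ ∑∑-adj G ⟨
    ∑ (allFin (k + 3)) (λ a → ∑ (allFin (k + 3)) (λ b → 𝟙 (adj G a b)))
      ≡⟨ ∑-cong (allFin (k + 3)) (λ a → ∑-cong (allFin (k + 3)) (λ b → cong 𝟙 (adj-G a b))) ⟩
    ∑ (allFin (k + 3)) (λ a → ∑ (allFin (k + 3)) (λ b → 𝟙 (E (splitAt k a) (splitAt k b))))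
      ≡⟨ ∑∑-splitAt k (λ p q → 𝟙 (E p q)) (λ p q → cong 𝟙 (E-sym p q)) ⟩
    -- The three inner sums belong to 0F, 1F and 2F, of which the first and last are attached, each
    -- to `s` alone. The final 4 counts the two edges of `path₃` in both orders.
    ∑ X (λ x → ∑ X (λ y → 𝟙 (adj T x y))) + 2 * (∑ X root + (∑ X (λ _ → 0) + (∑ X root + 0))) + 4
      ≡⟨ cong₂ (λ a b → a + 2 * b + 4) (∑∑-adj T) (cong₂ (λ a b → a + (b + (a + 0))) root-sum (∑-zero X)) ⟩
    2 * edgeCount T + 4 + 4
      ≡⟨ regroup (edgeCount T) ⟩
    2 * (suc (edgeCount T) + 3)
      ≡⟨ cong (λ m → 2 * (m + 3)) edges ⟩
    2 * (k + 3) ∎)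
    where
    open ≡-Reasoning
    root : Fin k → ℕ
    root x = 𝟙 ⌊ x Fin.≟ s ⌋
    root-sum : ∑ X root ≡ 1
    root-sum = trans (∑-cong X (λ x → sym (*-identityʳ (root x)))) (∑-δ s (λ _ → 1))
    regroup : ∀ e → 2 * e + 4 + 4 ≡ 2 * (suc e + 3)
    regroup = solve-∀

  C : I → I → ℕ
  C p q = ∑ X (λ x → 𝟙 (D p (inj₁ x) <ᵇ D q (inj₁ x))) + ∑ (allFin 3) (λ z → 𝟙 (D p (inj₂ z) <ᵇ D q (inj₂ z)))

  -- Each edge of the 4-cycle has one end nearer to `s`. All of T and one new vertex lie on its
  -- side, the other two new vertices on the far side: hence the counts k + 1 and 2.
  everywhere : ∑ X (λ x → 𝟙 (d s x <ᵇ suc (d s x))) ≡ k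
  everywhere = trans (∑-cong X (λ x → cong 𝟙 (<ᵇ-true (≤-refl {suc (d s x)}))))
    (trans (∑-const X 1) (trans (*-identityʳ _) (length-allFin k)))

  nowhere : ∑ X (λ x → 𝟙 (suc (d s x) <ᵇ d s x)) ≡ 0
  nowhere = trans (∑-cong X (λ x → cong 𝟙 (<ᵇ-false (n≤1+n (d s x))))) (∑-zero X)

  C-s0 : C (inj₁ s) (inj₂ 0F) ≡ k + 1
  C-s0 rewrite d-refl s = cong (_+ 1) everywhere

  C-0s : C (inj₂ 0F) (inj₁ s) ≡ 2
  C-0s rewrite d-refl s = cong (_+ 2) nowhere

  C-s2 : C (inj₁ s) (inj₂ 2F) ≡ k + 1
  C-s2 rewrite d-refl s = cong (_+ 1) everywhere

  C-2s : C (inj₂ 2F) (inj₁ s) ≡ 2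
  C-2s rewrite d-refl s = cong (_+ 2) nowhere

  szTerm : I → I → ℕ
  szTerm p q = 𝟙 (E p q) * (C p q * C q p)

  szTerm-sym : ∀ p q → szTerm p q ≡ szTerm q p
  szTerm-sym p q = cong₂ (λ b m → 𝟙 b * m) (E-sym p q) (*-comm (C p q) (C q p))

  -- For an edge xy of T the three new vertices join the side of `s`, raising one of the two counts
  -- by 3. In the expanded product the term with 9 vanishes, as `s` is not on both sides; the mixed
  -- terms give 3 in each orientation, hence 6.
  tree-part : ∑ X (λ x → ∑ X (λ y → szTerm (inj₁ x) (inj₁ y)))
    ≤ ∑ X (λ u → ∑ X (d u)) + 6 * ∑ X (d s)
  tree-part = begin
    ∑ X (λ x → ∑ X (λ y → szTerm (inj₁ x) (inj₁ y)))
      ≡⟨ ∑-cong X (λ x → ∑-cong X (λ y → expand x y)) ⟩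
    ∑ X (λ x → ∑ X (λ y → base x y + (3 * side x y + 3 * side y x)))
      ≡⟨ ∑-cong X (λ x → trans (∑-+ X (base x) _) (cong (∑ X (base x) +_) (trans (∑-+ X _ _)
           (cong₂ _+_ (∑-*ˡ X 3 (side x)) (∑-*ˡ X 3 (λ y → side y x)))))) ⟩
    ∑ X (λ x → ∑ X (base x) + (3 * ∑ X (side x) + 3 * ∑ X (λ y → side y x)))
      ≡⟨ trans (∑-+ X _ _) (cong (∑ X (λ x → ∑ X (base x)) +_) (trans (∑-+ X _ _)
           (cong₂ _+_ (∑-*ˡ X 3 (λ x → ∑ X (side x))) (∑-*ˡ X 3 (λ x → ∑ X (λ y → side y x)))))) ⟩
    ∑ X (λ x → ∑ X (base x)) + (3 * S + 3 * ∑ X (λ x → ∑ X (λ y → side y x)))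
      ≡⟨ cong (λ m → ∑ X (λ x → ∑ X (base x)) + (3 * S + 3 * m)) (∑-swap X X (λ x y → side y x)) ⟩
    ∑ X (λ x → ∑ X (base x)) + (3 * S + 3 * S)
      ≡⟨ cong (∑ X (λ x → ∑ X (base x)) +_) (six S) ⟩
    ∑ X (λ x → ∑ X (base x)) + 6 * S
      ≤⟨ +-mono-≤ sz≤ (*-monoʳ-≤ 6 (far-side≤ s)) ⟩
    ∑ X (λ u → ∑ X (d u)) + 6 * ∑ X (d s) ∎
    where
    open ≤-Reasoning
    l : Fin k → Fin k → ℕ
    l x y = 𝟙 (d x s <ᵇ d y s)
    base side : Fin k → Fin k → ℕ
    base x y = 𝟙 (adj T x y) * (closerCount d x y * closerCount d y x)
    side x y = 𝟙 (adj T x y) * (l x y * closerCount d y x)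
    S = ∑ X (λ x → ∑ X (side x))
    six : ∀ m → 3 * m + 3 * m ≡ 6 * m
    six = solve-∀
    l-exclusive : ∀ x y → l x y * l y x ≡ 0
    l-exclusive x y with <-cmp (d x s) (d y s)
    ... | tri< lt _ _ rewrite <ᵇ-false (<⇒≤ lt) = *-zeroʳ (l x y)
    ... | tri≈ _ eq _ rewrite eq | <ᵇ-false (≤-refl {d y s}) = refl
    ... | tri> _ _ gt rewrite <ᵇ-false (<⇒≤ gt) = refl
    multiply : ∀ e m m′ a b → e * ((m + (a + (a + (a + 0)))) * (m′ + (b + (b + (b + 0)))))
      ≡ e * (m * m′) + (3 * (e * (a * m′)) + 3 * (e * (b * m))) + 9 * e * (a * b)
    multiply = solve-∀
    expand : ∀ x y → szTerm (inj₁ x) (inj₁ y) ≡ base x y + (3 * side x y + 3 * side y x)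
    expand x y = trans (multiply (𝟙 (adj T x y)) (closerCount d x y) (closerCount d y x) (l x y) (l y x))
      (trans (cong₂ (λ b m → base x y + (3 * side x y + 3 * (𝟙 b * (l y x * closerCount d x y))) + 9 * 𝟙 (adj T x y) * m)
               (Graph.sym T x y) (l-exclusive x y))
             (trans (cong (base x y + (3 * side x y + 3 * side y x) +_) (*-zeroʳ (9 * 𝟙 (adj T x y)))) (+-identityʳ _)))

  root-part : ∑ (allFin 3) (λ z → ∑ X (λ x → szTerm (inj₁ x) (inj₂ z))) ≡ 2 * ((k + 1) * 2)
  root-part = cong₂ _+_
    (trans (∑-δ s (λ x → C (inj₁ x) (inj₂ 0F) * C (inj₂ 0F) (inj₁ x))) (cong₂ _*_ C-s0 C-0s))
    (cong₂ _+_ (∑-zero X) (cong (_+ 0)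
      (trans (∑-δ s (λ x → C (inj₁ x) (inj₂ 2F) * C (inj₂ 2F) (inj₁ x))) (cong₂ _*_ C-s2 C-2s))))

  path-part : ∑ (allFin 3) (λ z → ∑ (allFin 3) (λ w → szTerm (inj₂ z) (inj₂ w))) ≡ 4 * ((k + 1) * 2)
  -- The ends of such an edge are at distances 1 + d s x and 2 + d s x from a tree vertex x;
  -- stripping the common successor leaves `everywhere` and `nowhere`.
  path-part = total (C (inj₂ 0F) (inj₂ 1F)) (C (inj₂ 1F) (inj₂ 0F)) (C (inj₂ 2F) (inj₂ 1F)) (C (inj₂ 1F) (inj₂ 2F))
    (cong (_+ 1) everywhere) (cong (_+ 2) nowhere) (cong (_+ 1) everywhere) (cong (_+ 2) nowhere)
    where
    collect : ∀ m → (m + 0 + 0) + (m + 0 + (m + 0 + 0) + (m + 0 + 0 + 0)) ≡ 4 * m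
    collect = solve-∀
    total : ∀ a b c e → a ≡ k + 1 → b ≡ 2 → c ≡ k + 1 → e ≡ 2 →
      (a * b + 0 + 0) + ((b * a + 0 + (e * c + 0 + 0)) + (c * e + 0 + 0 + 0)) ≡ 4 * ((k + 1) * 2)
    total a b c e refl refl refl refl rewrite *-comm 2 (k + 1) = collect ((k + 1) * 2)

  Sz-upper : 2 * Sz G ≤ ∑ X (λ u → ∑ X (d u)) + 6 * ∑ X (d s) + 2 * (2 * ((k + 1) * 2)) + 4 * ((k + 1) * 2)
  Sz-upper = begin
    2 * Sz G
      ≡⟨ ∑∑-closerCount dG-isMetric ⟨
    ∑ (allFin (k + 3)) (λ a → ∑ (allFin (k + 3)) (λ b → 𝟙 (adj G a b) * (closerCount dG a b * closerCount dG b a)))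
      ≡⟨ ∑-cong (allFin (k + 3)) (λ a → ∑-cong (allFin (k + 3)) (λ b →
           cong₂ (λ e m → 𝟙 e * m) (adj-G a b) (cong₂ _*_ (count a b) (count b a)))) ⟩
    ∑ (allFin (k + 3)) (λ a → ∑ (allFin (k + 3)) (λ b → szTerm (splitAt k a) (splitAt k b)))
      ≡⟨ ∑∑-splitAt k szTerm szTerm-sym ⟩
    ∑ X (λ x → ∑ X (λ y → szTerm (inj₁ x) (inj₁ y)))
      + 2 * ∑ (allFin 3) (λ z → ∑ X (λ x → szTerm (inj₁ x) (inj₂ z)))
      + ∑ (allFin 3) (λ z → ∑ (allFin 3) (λ w → szTerm (inj₂ z) (inj₂ w)))
      ≤⟨ +-mono-≤ (+-mono-≤ tree-part (≤-reflexive (cong (2 *_) root-part))) (≤-reflexive path-part) ⟩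
    ∑ X (λ u → ∑ X (d u)) + 6 * ∑ X (d s) + 2 * (2 * ((k + 1) * 2)) + 4 * ((k + 1) * 2) ∎
    where
    open ≤-Reasoning
    count : ∀ a b → closerCount dG a b ≡ C (splitAt k a) (splitAt k b)
    count a b = ∑-splitAt k (λ p → 𝟙 (D (splitAt k a) p <ᵇ D (splitAt k b) p))

  -- The 6 stands for three new vertices in two orders, 8 k is 2 k (1 + 2 + 1) from the heights, and
  -- the last 8 is the sum of `d₃` over ordered pairs.
  W-G : 2 * W G ≡ ∑ X (λ u → ∑ X (d u)) + 6 * ∑ X (d s) + 8 * k + 8
  W-G = begin
    2 * W G
      ≡⟨ ∑∑-metric dG-isMetric ⟨
    ∑ (allFin (k + 3)) (λ a → ∑ (allFin (k + 3)) (λ b → D (splitAt k a) (splitAt k b)))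
      ≡⟨ ∑∑-splitAt k D D-sym ⟩
    ∑ X (λ u → ∑ X (d u)) + 2 * (column 0F + (column 1F + (column 2F + 0))) + 8
      ≡⟨ cong (λ m → ∑ X (λ u → ∑ X (d u)) + 2 * m + 8)
           (cong₂ _+_ (column-sum 0F) (cong₂ _+_ (column-sum 1F) (cong (_+ 0) (column-sum 2F)))) ⟩
    ∑ X (λ u → ∑ X (d u)) + 2 * (k * 1 + ∑ X (d s) + (k * 2 + ∑ X (d s) + (k * 1 + ∑ X (d s) + 0))) + 8
      ≡⟨ regroup (∑ X (λ u → ∑ X (d u))) k (∑ X (d s)) ⟩
    ∑ X (λ u → ∑ X (d u)) + 6 * ∑ X (d s) + 8 * k + 8 ∎
    where
    open ≡-Reasoning
    column : Fin 3 → ℕ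
    column z = ∑ X (λ x → height z + d x s)
    column-sum : ∀ z → column z ≡ k * height z + ∑ X (d s)
    column-sum z = trans (∑-+ X (λ _ → height z) (λ x → d x s))
      (cong₂ _+_ (trans (∑-const X (height z)) (cong (_* height z) (length-allFin k))) (∑-cong X (λ x → d-sym x s)))
    regroup : ∀ w k t → w + 2 * (k * 1 + t + (k * 2 + t + (k * 1 + t + 0))) + 8 ≡ w + 6 * t + 8 * k + 8
    regroup = solve-∀

  -- The terms of T agree in `Sz-upper` and `W-G`. The four cycle edges give 16 (k + 1), which
  -- exceeds 8 k + 8 by 2 (4 k + 4), and 4 k + 4 is 4 n - 8 for n = k + 3.
  Sz≤ : Sz G ≤ W G + (4 * (k + 3) ∸ 8)
  Sz≤ = *-cancelˡ-≤ 2 (begin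
    2 * Sz G                                                                  ≤⟨ Sz-upper ⟩
    w + 6 * t + 2 * (2 * ((k + 1) * 2)) + 4 * ((k + 1) * 2)                   ≡⟨ regroup w t k ⟩
    (w + 6 * t + 8 * k + 8) + 2 * (4 * k + 4)                                 ≡⟨ cong₂ (λ a b → a + 2 * b) W-G excess≡ ⟨
    2 * W G + 2 * (4 * (k + 3) ∸ 8)                                           ≡⟨ *-distribˡ-+ 2 (W G) (4 * (k + 3) ∸ 8) ⟨
    2 * (W G + (4 * (k + 3) ∸ 8))                                             ∎)
    where
    open ≤-Reasoning
    w = ∑ X (λ u → ∑ X (d u))
    t = ∑ X (d s)
    regroup : ∀ w t k → w + 6 * t + 2 * (2 * ((k + 1) * 2)) + 4 * ((k + 1) * 2) ≡ (w + 6 * t + 8 * k + 8) + 2 * (4 * k + 4)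
    regroup = solve-∀
    distribute : ∀ k → 4 * (k + 3) ≡ (4 * k + 4) + 8
    distribute = solve-∀
    excess≡ : 4 * (k + 3) ∸ 8 ≡ 4 * k + 4
    excess≡ = trans (cong (_∸ 8) (distribute k)) (m+n∸n≡m (4 * k + 4) 8)

gAdj-glued : ∀ {j} (T : Graph (suc j)) s a b → gAdj T s a b ≡ gluedAdj T s (splitAt (suc j) a) (splitAt (suc j) b)
gAdj-glued {j} T s a b with splitAt (suc j) a | splitAt (suc j) b
... | inj₁ x | inj₁ y  = refl
... | inj₁ x | inj₂ 0F = refl
... | inj₁ x | inj₂ 1F = refl
... | inj₁ x | inj₂ 2F = refl
... | inj₂ 0F | inj₁ x = refl
... | inj₂ 1F | inj₁ x = refl
... | inj₂ 2F | inj₁ x = refl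
... | inj₂ 0F | inj₂ 0F = refl
... | inj₂ 0F | inj₂ 1F = refl
... | inj₂ 0F | inj₂ 2F = refl
... | inj₂ 1F | inj₂ 0F = refl
... | inj₂ 1F | inj₂ 1F = refl
... | inj₂ 1F | inj₂ 2F = refl
... | inj₂ 2F | inj₂ 0F = refl
... | inj₂ 2F | inj₂ 1F = refl
... | inj₂ 2F | inj₂ 2F = refl

theorem2p2 : ((n : ℕ) (G : Graph n) → 4 ≤ n → Connected G → Bipartite G → n ≤ edgeCount G →
    W G + (4 * n ∸ 8) ≤ Sz G)
    ×
    ((j : ℕ) (T : Graph (suc j)) (s : Fin (suc j)) → Tree T →
    Connected (C4⊙T T s) × Bipartite (C4⊙T T s) × suc j + 3 ≤ edgeCount (C4⊙T T s)
    × Sz (C4⊙T T s) ≡ W (C4⊙T T s) + (4 * (suc j + 3) ∸ 8))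
theorem2p2 = bipartite-lower-bound , λ j T s (conn , edges) →
  let d , bounds = tree-bounds T conn (cong suc edges)
      module H = Glue T s (C4⊙T T s) (gAdj-glued T s) d bounds (cong suc edges)
      enough = ≤-reflexive (sym H.edgeCount-G)
  in H.connected , H.bipartite , enough ,
     ≤-antisym H.Sz≤ (bipartite-lower-bound (suc j + 3) (C4⊙T T s) (s≤s (m≤n+m 3 j)) H.connected H.bipartite enough)
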